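{- Let $G$ be a connected unweighted graph of order $n\ge2$ and let $e$ be an edge of $G$ such that $H=G-\{e\}$ is connected. Then $$K(H)\ \ge\ K(G)+\frac12-\frac{2}{\phi(G)^2}.$$
   Context: Graphs are finite, simple, connected and undirected; unweighted means all edge weights are $1$. For $S\subseteq V$, $\operatorname{vol}(S)$ is the sum of degrees of vertices in $S$ and $\bar S=V\setminus S$. The conductance of $G$ is $$\phi(G)=\min_{\emptyset\ne S\subsetneq V}\frac{|\{\text{edges between } S \text{ and } \bar S\}|}{\min(\operatorname{vol}(S),\operatorname{vol}(\bar S))}.$$ For a graph $G$ with $n$ vertices, adjacency matrix $A$ and diagonal degree matrix $D$, Kemeny's constant is $K(G)=\sum_i\pi_i m_{ji}-1$ for the random walk with transition matrix $D^{ -1}A$, where $\pi$ is the stationary distribution and $m_{ji}$ the mean first passage time from $j$ to $i$ (with $m_{jj}$ the mean first return time); this does not depend on $j$, and it is known that $K(G)=\sum_{j=1}^{n-1}\frac{1}{\mu_j}$, where $\mu_1\ge\cdots\ge\mu_{n-1}>\mu_n=0$ are the eigenvalues of the normalized Laplacian $I-D^{ -1/2}AD^{ -1/2}$. $G-\{e\}$ is the graph on the same vertex set with edge $e$ removed. -}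

module Defs where

open import Algebra.Bundles using (CommutativeRing)
import Algebra.Properties.Semiring.Sum as Sum
open import Data.Bool.Base using (Bool; true; false; _∧_; _∨_; not; if_then_else_)
open import Data.Bool.Properties using (∧-comm; ∨-comm)
open import Data.Fin.Base using (Fin; toℕ)
open import Data.Fin.Properties using (_≟_)
open import Data.Fin.Subset using (Subset; Nonempty; _⊂_; ⊤; ∁)
open import Data.Integer.Base using (+_)
open import Data.Nat.Base as ℕ using (ℕ; zero; suc)
import Data.Nat.Properties as ℕ
open import Data.Product.Base using (∃-syntax; _×_)
open import Data.Rational.Base
  using (ℚ; 0ℚ; 1ℚ; _+_; _*_; _-_; _/_; _÷_; ∣_∣; _≤_; _<_; ≢-nonZero)
import Data.Rational.Properties as ℚ
open import Data.Vec.Base using (lookup)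
open import Relation.Binary.Construct.Closure.ReflexiveTransitive using (Star)
open import Relation.Binary.PropositionalEquality using (_≡_; cong; cong₂; trans)
open import Relation.Nullary.Decidable using (yes; no; does)

open Sum ℕ.+-*-semiring public
  using () renaming (sum to sumℕ)
open Sum (CommutativeRing.semiring ℚ.+-*-commutativeRing) public
  using () renaming (sum to sumℚ)

private
  variable
    n : ℕ

fromℕ : ℕ → ℚ
fromℕ k = + k / 1

-- Division with the convention p ÷₀ 0 = 0.  The divisors it is applied to
-- (degrees, volumes of nonempty proper vertex sets, the square of the
-- conductance) are all nonzero for a connected graph on at least two vertices.
infixl 7 _÷₀_
_÷₀_ : ℚ → ℚ → ℚ
p ÷₀ q with q ℚ.≟ 0ℚ
... | yes _   = 0ℚ
... | no q≢0 = _÷_ p q {{≢-nonZero q≢0}}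

------------------------------------------------------------------------
-- Graphs

record Graph (n : ℕ) : Set where
  field
    adj       : Fin n → Fin n → Bool
    symmetric : ∀ i j → adj i j ≡ adj j i
    loopless  : ∀ i → adj i i ≡ false

open Graph public

Edge : Graph n → Fin n → Fin n → Set
Edge G i j = adj G i j ≡ true

Connected : Graph n → Set
Connected G = ∀ i j → Star (Edge G) i j

-- Whether the unordered pairs {u , v} and {i , j} coincide.
samePair : (u v i j : Fin n) → Bool
samePair u v i j =
  (does (i ≟ u) ∧ does (j ≟ v)) ∨ (does (i ≟ v) ∧ does (j ≟ u))

samePair-sym : ∀ (u v i j : Fin n) → samePair u v i j ≡ samePair u v j i
samePair-sym u v i j = trans
  (∨-comm (does (i ≟ u) ∧ does (j ≟ v)) _)
  (cong₂ _∨_ (∧-comm (does (i ≟ v)) _) (∧-comm (does (i ≟ u)) _))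

deleteEdge : Graph n → (u v : Fin n) → Graph n
deleteEdge G u v = record
  { adj       = λ i j → adj G i j ∧ not (samePair u v i j)
  ; symmetric = λ i j →
      cong₂ _∧_ (symmetric G i j) (cong not (samePair-sym u v i j))
  ; loopless  = λ i → cong (_∧ not (samePair u v i i)) (loopless G i)
  }

adjacency : Graph n → Fin n → Fin n → ℕ
adjacency G i j = if adj G i j then 1 else 0

degree : Graph n → Fin n → ℕ
degree G i = sumℕ λ j → adjacency G i j

------------------------------------------------------------------------
-- Conductance

vol : Graph n → Subset n → ℕ
vol G S = sumℕ λ i → if lookup S i then degree G i else 0

-- An edge between S and ∁ S has exactly one orientation (i , j) with
-- i ∈ S and j ∉ S, so it is counted once.
cutSize : Graph n → Subset n → ℕ
cutSize G S = sumℕ λ i → sumℕ λ j →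
  if lookup S i ∧ not (lookup S j) then adjacency G i j else 0

cutRatio : Graph n → Subset n → ℚ
cutRatio G S = fromℕ (cutSize G S) ÷₀ fromℕ (vol G S ℕ.⊓ vol G (∁ S))

-- φ is the minimum of the cut ratios over all S with ∅ ≠ S ⊊ V.
record IsConductance (G : Graph n) (φ : ℚ) : Set where
  field
    attained   : ∃[ S ] (Nonempty S × S ⊂ ⊤ × φ ≡ cutRatio G S)
    lowerBound : ∀ S → Nonempty S → S ⊂ ⊤ → φ ≤ cutRatio G S

------------------------------------------------------------------------
-- Random walks and Kemeny's constant

transition : Graph n → Fin n → Fin n → ℚ
transition G i j = fromℕ (adjacency G i j) ÷₀ fromℕ (degree G i)

record IsStationary (P : Fin n → Fin n → ℚ) (π : Fin n → ℚ) : Set where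
  field
    nonNegative : ∀ i → 0ℚ ≤ π i
    normalised  : sumℚ π ≡ 1ℚ
    invariant   : ∀ j → sumℚ (λ i → π i * P i j) ≡ π j

-- firstPassage P t j i is the probability that the chain started at j
-- satisfies T = t, where T = min { t ≥ 1 : X t = i }; for j = i this T is
-- the first return time.  The recursion conditions on the first step.
firstPassage : (Fin n → Fin n → ℚ) → ℕ → Fin n → Fin n → ℚ
firstPassage P zero          j i = 0ℚ
firstPassage P (suc zero)    j i = P j i
firstPassage P (suc (suc t)) j i = sumℚ λ k →
  if does (k ≟ i) then 0ℚ else P j k * firstPassage P (suc t) k i

partialSum : (ℕ → ℚ) → ℕ → ℚ
partialSum a N = sumℚ {N} λ t → a (toℕ t)

SumsTo : (ℕ → ℚ) → ℚ → Set
SumsTo a s =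
  ∀ ε → 0ℚ < ε → ∃[ N ] (∀ k → N ℕ.≤ k → ∣ partialSum a k - s ∣ < ε)

-- m j i is the expectation Σ t · Pr(T = t) of the first passage time T from
-- j to i.  For a finite irreducible chain T is almost surely finite, and the
-- expectation is rational whenever the transition probabilities are.
IsMeanFirstPassage : (Fin n → Fin n → ℚ) → (Fin n → Fin n → ℚ) → Set
IsMeanFirstPassage P m =
  ∀ j i → SumsTo (λ t → fromℕ t * firstPassage P t j i) (m j i)

-- The value does not depend on the starting vertex, so K is required to be
-- the value for some start; requiring it for all of them would build this
-- independence into the definition.
record IsKemeny (G : Graph n) (K : ℚ) : Set where
  field
    π                : Fin n → ℚ
    m                : Fin n → Fin n → ℚ
    stationary       : IsStationary (transition G) π
    meanFirstPassage : IsMeanFirstPassage (transition G) m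
    start            : Fin n
    value            : K ≡ sumℚ (λ i → π i * m start i) - 1ℚ

-- Write d for the degrees, M = ∑ d, Lap = D - A, and h i for the hitting times of
-- i.  The first-step equations say that Lap (h i) = d - M δ i, and Kemeny's
-- constant satisfies M K = ∑ i, d i * h i j for every j.  Thus M² K is a sum of
-- Dirichlet energies, and M M′ K can be compared with M M′ K′ for the graph
-- without the edge u v by Rayleigh monotonicity (deleting the edge only raises
-- effective resistances); what is lost in the change of weights from d to d′ is
-- at most d ∙ h u + d ∙ h v.
--
-- This loss is bounded through a Poincaré inequality, from Cheeger's argument
-- (co-area formula on the two sides of a median).  In the sharp form
-- E (2 D - E) ≥ φ² D², with E the energy and D the weighted square norm, it gives
-- D ≤ (2 / φ² - 1 / 2) E, which is where the summand 1 / 2 comes from.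
-- Both end points have degree at least 2, so d ∙ h u and d ∙ h v are each at most
-- half of (2 / φ² - 1 / 2) M M′.  No eigenvalues occur, so everything stays in ℚ.

module Submission where

open import Defs
open import Algebra.Bundles using (CommutativeRing)
import Algebra.Properties.Semiring.Sum as SemiringSum
open import Data.Bool.Base using (Bool; true; false; _∧_; not; if_then_else_)
import Data.Bool.Properties as Bool
open import Data.Fin.Base using (Fin; zero; suc; toℕ)
open import Data.Fin.Properties using (_≟_; any?)
open import Data.Fin.Subset using (Subset; Nonempty; _∈_; ⊤; ∁; _⊂_)
  renaming (_-_ to _∖_)
open import Data.Fin.Subset.Induction using (⊂-wellFounded; Acc; acc)
import Data.Fin.Subset.Properties as Sub
import Data.Integer.Base as ℤ
import Data.Integer.Properties as ℤ
import Data.Nat.Base as ℕ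
open import Data.Nat.Base using (ℕ)
import Data.Nat.Properties as ℕ
open import Data.Product.Base using (∃; ∃-syntax; _×_; _,_; proj₁; proj₂)
open import Data.Rational.Base
  using (ℚ; 0ℚ; 1ℚ; ½; _+_; _*_; _-_; -_; _≤_; _<_; _≥_; ∣_∣; _⊔_; 1/_; toℚᵘ; ≢-nonZero;
         positive; nonNegative)
import Data.Rational.Properties as ℚ
open import Data.Rational.Properties using (module ≤-Reasoning)
open import Data.Rational.Unnormalised.Base as ℚᵘ using (*≡*; mkℚᵘ)
import Data.Rational.Unnormalised.Properties as ℚᵘ
open import Data.Sum.Base using (inj₁; inj₂)
open import Data.Vec.Base using (lookup; tabulate)
open import Data.Vec.Properties using (lookup∘tabulate; lookup-map; []=⇒lookup; lookup⇒[]=)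
open import Function.Base using (_∘_)
open import Level using (0ℓ)
open import Relation.Binary.Construct.Closure.ReflexiveTransitive using (Star; _◅_) renaming (ε to ε⋆)
open import Relation.Binary.PropositionalEquality
  using (_≡_; _≢_; refl; sym; trans; cong; cong₂; subst; module ≡-Reasoning)
open import Relation.Nullary.Decidable using (yes; no; does; Dec; dec⇒maybe; dec-true; dec-false)
open import Relation.Nullary.Negation.Core using (¬_; contradiction)
open import Tactic.RingSolver using (solve-∀)
open import Tactic.RingSolver.Core.AlmostCommutativeRing
  using (AlmostCommutativeRing; fromCommutativeRing)

-- The obstacle in comparing the two graphs is that their Poisson equations have different
-- right-hand sides, `d - M δ i` and `d′ - M′ δ i`. Since `M = M′ + 2` and `d = d′ + δ u + δ v`, the
-- combination `M′ h i + h u + h v` solves the equation of the smaller graph, scaled by `M`, on the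
-- larger graph, and so makes the energies comparable. The Poincaré inequality bounds `T = d ∙ h u`
-- because `T` occurs twice: `2 T` is the energy of `h u` summed over ordered pairs, and `d u * T`
-- is the weighted pairing of `h u` with `d u - M δ u`. Cauchy-Schwarz then bounds `T²` by a
-- multiple of `T`. The test vector has weighted mean zero, so the centre in the Poincaré inequality
-- is free and can be a median. On the probabilistic side the data give only convergence of the mean
-- first passage times. That the passage probabilities add up to one follows from uniqueness of the
-- solution of a linear system, which is again a statement about functions of zero energy.

private
  module Sumℚ = SemiringSum (CommutativeRing.semiring ℚ.+-*-commutativeRing)

private
  variable
    n : ℕ
    p q r : ℚ

-- Ordered field arithmetic in ℚ

ℚ-ring : AlmostCommutativeRing 0ℓ 0ℓ
ℚ-ring = fromCommutativeRing ℚ.+-*-commutativeRing λ p → dec⇒maybe (0ℚ ℚ.≟ p)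

2ℚ : ℚ
2ℚ = 1ℚ + 1ℚ

*-exchange : ∀ a b c → a * (b * c) ≡ b * (a * c)
*-exchange = solve-∀ ℚ-ring

*-factorˡ : ∀ a b c → a * b - a * c ≡ a * (b - c)
*-factorˡ = solve-∀ ℚ-ring

p≡p+q-q : ∀ p q → p ≡ p + q - q
p≡p+q-q = solve-∀ ℚ-ring

2*p≡p+p : ∀ p → 2ℚ * p ≡ p + p
2*p≡p+p = solve-∀ ℚ-ring

-- The usual route to a polynomial inequality below: the slack `r` is written as a sum of visibly
-- nonnegative products, and `q ≡ p + r` becomes a ring identity.
≤-by : ∀ r → 0ℚ ≤ r → q ≡ p + r → p ≤ q
≤-by {p = p} r 0≤r refl = subst (_≤ p + r) (ℚ.+-identityʳ p) (ℚ.+-monoʳ-≤ p 0≤r)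

≤⇒0≤- : p ≤ q → 0ℚ ≤ q - p
≤⇒0≤- {p} {q} p≤q = subst (_≤ q - p) (ℚ.+-inverseʳ p) (ℚ.+-monoˡ-≤ (- p) p≤q)

0≤+ : 0ℚ ≤ p → 0ℚ ≤ q → 0ℚ ≤ p + q
0≤+ 0≤p 0≤q = ℚ.+-mono-≤ 0≤p 0≤q

*-monoˡ-≤ : 0ℚ ≤ r → p ≤ q → r * p ≤ r * q
*-monoˡ-≤ {r} 0≤r = ℚ.*-monoˡ-≤-nonNeg r {{nonNegative 0≤r}}

0≤* : 0ℚ ≤ p → 0ℚ ≤ q → 0ℚ ≤ p * q
0≤* {p} {q} 0≤p 0≤q = subst (_≤ p * q) (ℚ.*-zeroʳ p) (*-monoˡ-≤ 0≤p 0≤q)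

0<* : 0ℚ < p → 0ℚ < q → 0ℚ < p * q
0<* {p} {q} 0<p 0<q =
  subst (_< p * q) (ℚ.*-zeroʳ p) (ℚ.*-monoʳ-<-pos p {{positive 0<p}} 0<q)

0<⇒≢0 : 0ℚ < p → p ≢ 0ℚ
0<⇒≢0 0<p refl = ℚ.<-irrefl refl 0<p

*-cancelˡ-≤ : 0ℚ < r → r * p ≤ r * q → p ≤ q
*-cancelˡ-≤ {r} 0<r = ℚ.*-cancelˡ-≤-pos r {{positive 0<r}}

*-cancelˡ : r ≢ 0ℚ → r * p ≡ r * q → p ≡ q
*-cancelˡ {r} {p} {q} r≢0 rp≡rq = begin
  p              ≡⟨ undo p ⟩
  1/ r * (r * p) ≡⟨ cong (1/ r *_) rp≡rq ⟩
  1/ r * (r * q) ≡⟨ sym (undo q) ⟩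
  q              ∎
  where
  open ≡-Reasoning
  instance _ = ≢-nonZero r≢0
  undo : ∀ x → x ≡ 1/ r * (r * x)
  undo x = sym (trans (sym (ℚ.*-assoc (1/ r) r x))
    (trans (cong (_* x) (ℚ.*-inverseˡ r)) (ℚ.*-identityˡ x)))

*≡0 : p ≢ 0ℚ → p * q ≡ 0ℚ → q ≡ 0ℚ
*≡0 {p} p≢0 pq≡0 = *-cancelˡ p≢0 (trans pq≡0 (sym (ℚ.*-zeroʳ p)))

0≤sq : ∀ p → 0ℚ ≤ p * p
0≤sq p with ℚ.≤-total 0ℚ p
... | inj₁ 0≤p = 0≤* 0≤p 0≤p
... | inj₂ p≤0 = subst (0ℚ ≤_) (neg-sq p) (0≤* 0≤-p 0≤-p)
  where
  0≤-p = ℚ.neg-antimono-≤ p≤0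
  neg-sq : ∀ p → - p * - p ≡ p * p
  neg-sq = solve-∀ ℚ-ring

sq≡0 : p * p ≡ 0ℚ → p ≡ 0ℚ
sq≡0 {p} pp≡0 with p ℚ.≟ 0ℚ
... | yes p≡0 = p≡0
... | no  p≢0 = *≡0 p≢0 pp≡0

-≡0 : p - q ≡ 0ℚ → p ≡ q
-≡0 {p} {q} e = trans (add-back p q) (trans (cong (_+ q) e) (ℚ.+-identityˡ q))
  where
  add-back : ∀ p q → p ≡ p - q + q
  add-back = solve-∀ ℚ-ring

÷₀-* : ∀ p → q ≢ 0ℚ → q * (p ÷₀ q) ≡ p
÷₀-* {q} p q≢0 with q ℚ.≟ 0ℚ
... | yes q≡0 = contradiction q≡0 q≢0
... | no  q≢0 = begin
  q * (p * 1/ q) ≡⟨ cong (q *_) (ℚ.*-comm p (1/ q)) ⟩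
  q * (1/ q * p) ≡⟨ sym (ℚ.*-assoc q (1/ q) p) ⟩
  q * 1/ q * p   ≡⟨ cong (_* p) (ℚ.*-inverseʳ q) ⟩
  1ℚ * p         ≡⟨ ℚ.*-identityˡ p ⟩
  p              ∎
  where
  open ≡-Reasoning
  instance _ = ≢-nonZero q≢0

∣∣-nonneg : 0ℚ ≤ p → ∣ p ∣ ≡ p
∣∣-nonneg = ℚ.0≤p⇒∣p∣≡p

∣∣-sq : ∀ p → ∣ p ∣ * ∣ p ∣ ≡ p * p
∣∣-sq p = trans (sym (ℚ.∣p*q∣≡∣p∣*∣q∣ p p)) (ℚ.0≤p⇒∣p∣≡p (0≤sq p))

-- Finite sums

opaque

  -- sumℚ, made opaque so that summands can be inferred by unification.
  ∑ : (Fin n → ℚ) → ℚ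
  ∑ = sumℚ

  ∑≡sumℚ : (f : Fin n → ℚ) → ∑ f ≡ sumℚ f
  ∑≡sumℚ f = refl

  ∑-suc : (f : Fin (ℕ.suc n) → ℚ) → ∑ f ≡ f zero + ∑ (f ∘ suc)
  ∑-suc f = refl

  ∑-zero : (f : Fin 0 → ℚ) → ∑ f ≡ 0ℚ
  ∑-zero f = refl

  ∑-cong : {f g : Fin n → ℚ} → (∀ i → f i ≡ g i) → ∑ f ≡ ∑ g
  ∑-cong = Sumℚ.sum-cong-≗

  ∑-+ : (f g : Fin n → ℚ) → ∑ (λ i → f i + g i) ≡ ∑ f + ∑ g
  ∑-+ = Sumℚ.∑-distrib-+

  ∑-*ˡ : ∀ c (f : Fin n → ℚ) → ∑ (λ i → c * f i) ≡ c * ∑ f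
  ∑-*ˡ c f = sym (Sumℚ.*-distribˡ-sum c f)

  ∑-*ʳ : ∀ c (f : Fin n → ℚ) → ∑ (λ i → f i * c) ≡ ∑ f * c
  ∑-*ʳ c f = sym (Sumℚ.*-distribʳ-sum c f)

  ∑-swap : ∀ {m} (F : Fin m → Fin n → ℚ) → ∑ (λ i → ∑ (λ j → F i j)) ≡ ∑ (λ j → ∑ (λ i → F i j))
  ∑-swap = Sumℚ.∑-comm

  ∑-0 : ∀ n → ∑ {n} (λ _ → 0ℚ) ≡ 0ℚ
  ∑-0 ℕ.zero    = refl
  ∑-0 (ℕ.suc n) = trans (ℚ.+-identityˡ _) (∑-0 n)

  ∑-mono : {f g : Fin n → ℚ} → (∀ i → f i ≤ g i) → ∑ f ≤ ∑ g
  ∑-mono {ℕ.zero}  f≤g = ℚ.≤-refl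
  ∑-mono {ℕ.suc n} f≤g = ℚ.+-mono-≤ (f≤g zero) (∑-mono (f≤g ∘ suc))

∑-≡0 : {f : Fin n → ℚ} → (∀ i → f i ≡ 0ℚ) → ∑ f ≡ 0ℚ
∑-≡0 f≡0 = trans (∑-cong f≡0) (∑-0 _)

∑-sub : (f g : Fin n → ℚ) → ∑ (λ i → f i - g i) ≡ ∑ f - ∑ g
∑-sub f g = begin
  ∑ (λ i → f i - g i)          ≡⟨ ∑-cong (λ i → minus (f i) (g i)) ⟩
  ∑ (λ i → f i + - 1ℚ * g i)   ≡⟨ ∑-+ f (λ i → - 1ℚ * g i) ⟩
  ∑ f + ∑ (λ i → - 1ℚ * g i)   ≡⟨ cong (∑ f +_) (∑-*ˡ (- 1ℚ) g) ⟩
  ∑ f + - 1ℚ * ∑ g             ≡⟨ sym (minus (∑ f) (∑ g)) ⟩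
  ∑ f - ∑ g                    ∎
  where
  open ≡-Reasoning
  minus : ∀ x y → x - y ≡ x + - 1ℚ * y
  minus = solve-∀ ℚ-ring

0≤∑ : {f : Fin n → ℚ} → (∀ i → 0ℚ ≤ f i) → 0ℚ ≤ ∑ f
0≤∑ {n} {f} 0≤f = subst (_≤ ∑ f) (∑-0 n) (∑-mono 0≤f)

term≤∑ : {f : Fin n → ℚ} → (∀ i → 0ℚ ≤ f i) → ∀ i → f i ≤ ∑ f
term≤∑ {f = f} 0≤f zero    = ≤-by _ (0≤∑ (0≤f ∘ suc)) (∑-suc f)
term≤∑ {f = f} 0≤f (suc i) = ≤-by (f zero + (∑ (f ∘ suc) - f (suc i)))
  (0≤+ (0≤f zero) (≤⇒0≤- (term≤∑ (0≤f ∘ suc) i)))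
  (trans (∑-suc f) (regroup (f zero) (∑ (f ∘ suc)) (f (suc i))))
  where
  regroup : ∀ a b c → a + b ≡ c + (a + (b - c))
  regroup = solve-∀ ℚ-ring

∑≡0⇒≡0 : {f : Fin n → ℚ} → (∀ i → 0ℚ ≤ f i) → ∑ f ≡ 0ℚ → ∀ i → f i ≡ 0ℚ
∑≡0⇒≡0 0≤f Σf≡0 i = ℚ.≤-antisym (subst (_ ≤_) Σf≡0 (term≤∑ 0≤f i)) (0≤f i)

δ : Fin n → Fin n → ℚ
δ i j = if does (i ≟ j) then 1ℚ else 0ℚ

δ-refl : (i : Fin n) → δ i i ≡ 1ℚ
δ-refl i rewrite dec-true (i ≟ i) refl = refl

δ-≢ : {i j : Fin n} → i ≢ j → δ i j ≡ 0ℚ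
δ-≢ {i = i} {j} i≢j rewrite dec-false (i ≟ j) i≢j = refl

δ-sym : (i j : Fin n) → δ i j ≡ δ j i
δ-sym i j with i ≟ j | j ≟ i
... | yes _   | yes _   = refl
... | no  _   | no  _   = refl
... | yes i≡j | no  j≢i = contradiction (sym i≡j) j≢i
... | no  i≢j | yes j≡i = contradiction (sym j≡i) i≢j

∑-δ : (i : Fin n) (f : Fin n → ℚ) → ∑ (λ j → δ j i * f j) ≡ f i
∑-δ {ℕ.suc n} zero f = begin
  ∑ (λ j → δ j zero * f j)        ≡⟨ ∑-suc _ ⟩
  1ℚ * f zero + ∑ (λ j → 0ℚ * f (suc j))
    ≡⟨ cong₂ _+_ (ℚ.*-identityˡ (f zero)) (∑-≡0 (λ j → ℚ.*-zeroˡ (f (suc j)))) ⟩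
  f zero + 0ℚ                     ≡⟨ ℚ.+-identityʳ (f zero) ⟩
  f zero                          ∎
  where open ≡-Reasoning
∑-δ (suc i) f = trans (∑-suc _)
  (trans (cong₂ _+_ (ℚ.*-zeroˡ (f zero)) (∑-δ i (f ∘ suc))) (ℚ.+-identityˡ (f (suc i))))

∑-δ-1 : (i : Fin n) → ∑ (λ j → δ j i) ≡ 1ℚ
∑-δ-1 i = trans (∑-cong λ j → sym (ℚ.*-identityʳ (δ j i))) (∑-δ i (λ _ → 1ℚ))

infix 7 _∙_
_∙_ : (a f : Fin n → ℚ) → ℚ
a ∙ f = ∑ λ i → a i * f i

∙-congʳ : ∀ (a : Fin n → ℚ) {f g} → (∀ i → f i ≡ g i) → a ∙ f ≡ a ∙ g
∙-congʳ a f≡g = ∑-cong λ i → cong (a i *_) (f≡g i)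

∙-comm : (a f : Fin n → ℚ) → a ∙ f ≡ f ∙ a
∙-comm a f = ∑-cong λ i → ℚ.*-comm (a i) (f i)

∙-+ʳ : (a f g : Fin n → ℚ) → a ∙ (λ i → f i + g i) ≡ a ∙ f + a ∙ g
∙-+ʳ a f g = trans (∑-cong λ i → ℚ.*-distribˡ-+ (a i) (f i) (g i))
  (∑-+ (λ i → a i * f i) (λ i → a i * g i))

∙-*ʳ : ∀ (a : Fin n → ℚ) c (f : Fin n → ℚ) → a ∙ (λ i → c * f i) ≡ c * (a ∙ f)
∙-*ʳ a c f = trans (∑-cong λ i → *-exchange (a i) c (f i)) (∑-*ˡ c (λ i → a i * f i))

∙-+ˡ : (a b f : Fin n → ℚ) → (λ i → a i + b i) ∙ f ≡ a ∙ f + b ∙ f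
∙-+ˡ a b f = trans (∑-cong λ i → ℚ.*-distribʳ-+ (f i) (a i) (b i))
  (∑-+ (λ i → a i * f i) (λ i → b i * f i))

∙-*ˡ : ∀ c (a f : Fin n → ℚ) → (λ i → c * a i) ∙ f ≡ c * (a ∙ f)
∙-*ˡ c a f = trans (∑-cong λ i → ℚ.*-assoc c (a i) (f i)) (∑-*ˡ c (λ i → a i * f i))

∙-constʳ : ∀ (a : Fin n → ℚ) c → a ∙ (λ _ → c) ≡ ∑ a * c
∙-constʳ a c = ∑-*ʳ c a

∙-swap : ∀ (a b : Fin n → ℚ) (F : Fin n → Fin n → ℚ) →
         a ∙ (λ i → b ∙ F i) ≡ b ∙ (λ j → a ∙ λ i → F i j)
∙-swap a b F = begin
  ∑ (λ i → a i * ∑ (λ j → b j * F i j))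
    ≡⟨ ∑-cong (λ i → trans (sym (∑-*ˡ (a i) (λ j → b j * F i j)))
         (∑-cong λ j → *-exchange (a i) (b j) (F i j))) ⟩
  ∑ (λ i → ∑ (λ j → b j * (a i * F i j)))
    ≡⟨ ∑-swap (λ i j → b j * (a i * F i j)) ⟩
  ∑ (λ j → ∑ (λ i → b j * (a i * F i j)))
    ≡⟨ ∑-cong (λ j → ∑-*ˡ (b j) (λ i → a i * F i j)) ⟩
  ∑ (λ j → b j * ∑ (λ i → a i * F i j)) ∎
  where
  open ≡-Reasoning

∑∑ : (Fin n → Fin n → ℚ) → ℚ
∑∑ F = ∑ λ i → ∑ λ j → F i j

∑∑-cong : {F G : Fin n → Fin n → ℚ} → (∀ i j → F i j ≡ G i j) → ∑∑ F ≡ ∑∑ G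
∑∑-cong F≡G = ∑-cong λ i → ∑-cong (F≡G i)

∑∑-mono : {F G : Fin n → Fin n → ℚ} → (∀ i j → F i j ≤ G i j) → ∑∑ F ≤ ∑∑ G
∑∑-mono F≤G = ∑-mono λ i → ∑-mono (F≤G i)

∑∑-+ : (F G : Fin n → Fin n → ℚ) → ∑∑ (λ i j → F i j + G i j) ≡ ∑∑ F + ∑∑ G
∑∑-+ F G = trans (∑-cong λ i → ∑-+ (F i) (G i)) (∑-+ (λ i → ∑ (F i)) (λ i → ∑ (G i)))

∑∑-* : ∀ c (F : Fin n → Fin n → ℚ) → ∑∑ (λ i j → c * F i j) ≡ c * ∑∑ F
∑∑-* c F = trans (∑-cong λ i → ∑-*ˡ c (F i)) (∑-*ˡ c (λ i → ∑ (F i)))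

-- `fromℕ` normalises its fraction and so does not compute on variables; for unnormalised fractions
-- the equation is one between integer numerators.
fromℕ-+ : ∀ a b → fromℕ (a ℕ.+ b) ≡ fromℕ a + fromℕ b
fromℕ-+ a b = ℚ.toℚᵘ-injective (begin
  toℚᵘ (fromℕ (a ℕ.+ b))           ≈⟨ ℚ.toℚᵘ-fromℚᵘ _ ⟩
  mkℚᵘ (ℤ.+ (a ℕ.+ b)) 0           ≈⟨ *≡* numerators ⟩
  mkℚᵘ (ℤ.+ a) 0 ℚᵘ.+ mkℚᵘ (ℤ.+ b) 0
    ≈⟨ ℚᵘ.+-cong (ℚ.toℚᵘ-fromℚᵘ (mkℚᵘ (ℤ.+ a) 0)) (ℚ.toℚᵘ-fromℚᵘ (mkℚᵘ (ℤ.+ b) 0)) ⟨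
  toℚᵘ (fromℕ a) ℚᵘ.+ toℚᵘ (fromℕ b) ≈⟨ ℚ.toℚᵘ-homo-+ (fromℕ a) (fromℕ b) ⟨
  toℚᵘ (fromℕ a + fromℕ b)         ∎)
  where
  open import Relation.Binary.Reasoning.Setoid ℚᵘ.≃-setoid
  numerators : ℤ.+ (a ℕ.+ b) ℤ.* ℤ.1ℤ ≡ (ℤ.+ a ℤ.* ℤ.1ℤ ℤ.+ ℤ.+ b ℤ.* ℤ.1ℤ) ℤ.* ℤ.1ℤ
  numerators = cong (ℤ._* ℤ.1ℤ) (trans (ℤ.pos-+ a b)
    (sym (cong₂ ℤ._+_ (ℤ.*-identityʳ (ℤ.+ a)) (ℤ.*-identityʳ (ℤ.+ b)))))

0≤fromℕ : ∀ a → 0ℚ ≤ fromℕ a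
0≤fromℕ ℕ.zero = ℚ.≤-refl
0≤fromℕ (ℕ.suc a) = subst (0ℚ ≤_) (sym (fromℕ-+ 1 a)) (0≤+ (ℚ.<⇒≤ (ℚ.positive⁻¹ 1ℚ)) (0≤fromℕ a))

fromℕ-mono : ∀ {a b} → a ℕ.≤ b → fromℕ a ≤ fromℕ b
fromℕ-mono {a} {b} a≤b = ≤-by (fromℕ (b ℕ.∸ a)) (0≤fromℕ (b ℕ.∸ a))
  (trans (cong fromℕ (sym (ℕ.m+[n∸m]≡n a≤b))) (fromℕ-+ a (b ℕ.∸ a)))

opaque
  unfolding ∑

  fromℕ-sum : (f : Fin n → ℕ) → fromℕ (sumℕ f) ≡ ∑ (λ i → fromℕ (f i))
  fromℕ-sum {ℕ.zero}  f = refl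
  fromℕ-sum {ℕ.suc n} f =
    trans (fromℕ-+ (f zero) _) (cong (fromℕ (f zero) +_) (fromℕ-sum (f ∘ suc)))

minimiser : (f : Fin n → ℚ) (P : Fin n → Bool) → ∃[ i ] P i ≡ true →
            ∃[ i ] (P i ≡ true × ∀ j → P j ≡ true → f i ≤ f j)
minimiser {ℕ.suc n} f P (k , Pk) with any? (λ j → P (suc j) Bool.≟ true)
minimiser {ℕ.suc n} f P (zero , Pk) | no ∄ = zero , Pk , λ where
  zero    _  → ℚ.≤-refl
  (suc j) Pj → contradiction (j , Pj) ∄
minimiser {ℕ.suc n} f P (suc k , Pk) | no ∄ = contradiction (k , Pk) ∄
... | yes ∃j with minimiser (f ∘ suc) (P ∘ suc) ∃j | P zero in P0
...   | i , Pi , i-min | false = suc i , Pi , λ where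
  zero    P0′ → contradiction (trans (sym P0) P0′) λ ()
  (suc j) Pj  → i-min j Pj
...   | i , Pi , i-min | true with ℚ.≤-total (f zero) (f (suc i))
...     | inj₁ f0≤fi = zero , P0 , λ where
  zero    _  → ℚ.≤-refl
  (suc j) Pj → ℚ.≤-trans f0≤fi (i-min j Pj)
...     | inj₂ fi≤f0 = suc i , Pi , λ where
  zero    _  → fi≤f0
  (suc j) Pj → i-min j Pj

-- The Laplacian of a graph and its Dirichlet form

module Network (G : Graph n) where

  opaque
    w : Fin n → Fin n → ℚ
    w i j = fromℕ (adjacency G i j)

    w-sym : ∀ i j → w i j ≡ w j i
    w-sym i j = cong (λ b → fromℕ (if b then 1 else 0)) (symmetric G i j)

    0≤w : ∀ i j → 0ℚ ≤ w i j
    0≤w i j = 0≤fromℕ (adjacency G i j)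

    edge⇒w≡1 : ∀ {i j} → Edge G i j → w i j ≡ 1ℚ
    edge⇒w≡1 e rewrite e = refl

    adjacency≡w : ∀ i j → fromℕ (adjacency G i j) ≡ w i j
    adjacency≡w i j = refl

  d : Fin n → ℚ
  d i = ∑ (w i)

  M : ℚ
  M = ∑ d

  Lap : (Fin n → ℚ) → Fin n → ℚ
  Lap f i = d i * f i - ∑ (λ j → w i j * f j)

  -- Twice the Dirichlet form: every edge contributes with both orientations.
  𝓔 : (f g : Fin n → ℚ) → ℚ
  𝓔 f g = ∑∑ λ i j → w i j * ((f i - f j) * (g i - g j))

  0≤d : ∀ i → 0ℚ ≤ d i
  0≤d i = 0≤∑ (0≤w i)

  degree≡d : ∀ i → fromℕ (degree G i) ≡ d i
  degree≡d i = trans (fromℕ-sum (adjacency G i)) (∑-cong (adjacency≡w i))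

  Lap-sum : ∀ f i → Lap f i ≡ ∑ (λ j → w i j * (f i - f j))
  Lap-sum f i = begin
    d i * f i - ∑ (λ j → w i j * f j)
      ≡⟨ cong (_- ∑ (λ j → w i j * f j)) (sym (∑-*ʳ (f i) (w i))) ⟩
    ∑ (λ j → w i j * f i) - ∑ (λ j → w i j * f j)
      ≡⟨ sym (∑-sub (λ j → w i j * f i) (λ j → w i j * f j)) ⟩
    ∑ (λ j → w i j * f i - w i j * f j)
      ≡⟨ ∑-cong (λ j → *-factorˡ (w i j) (f i) (f j)) ⟩
    ∑ (λ j → w i j * (f i - f j)) ∎
    where
    open ≡-Reasoning

  -- Writing `Lap g` as a sum of differences and adding the same sum with `i` and `j` exchanged
  -- symmetrises the left-hand side; this is the origin of the factor `2ℚ`.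
  green : ∀ f g → 2ℚ * ∑ (λ i → f i * Lap g i) ≡ 𝓔 f g
  green f g = begin
    2ℚ * X                         ≡⟨ 2*p≡p+p X ⟩
    X + X                          ≡⟨ cong₂ _+_ X≡ (trans X≡ (trans (∑-swap (λ i j → w i j * (f i * (g i - g j)))) (∑∑-cong flip))) ⟩
    ∑∑ (λ i j → w i j * (f i * (g i - g j))) +
      ∑∑ (λ i j → w i j * (f j * (g j - g i)))
                                   ≡⟨ sym (∑∑-+ (λ i j → w i j * (f i * (g i - g j))) (λ i j → w i j * (f j * (g j - g i)))) ⟩
    ∑∑ (λ i j → w i j * (f i * (g i - g j)) + w i j * (f j * (g j - g i)))
                                   ≡⟨ ∑∑-cong (λ i j → collect (w i j) (f i) (f j) (g i) (g j)) ⟩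
    𝓔 f g                         ∎
    where
    open ≡-Reasoning
    X = ∑ (λ i → f i * Lap g i)
    collect : ∀ a b c x y → a * (b * (x - y)) + a * (c * (y - x)) ≡ a * ((b - c) * (x - y))
    collect = solve-∀ ℚ-ring
    X≡ : X ≡ ∑∑ (λ i j → w i j * (f i * (g i - g j)))
    X≡ = ∑-cong λ i → trans (cong (f i *_) (Lap-sum g i))
      (trans (sym (∑-*ˡ (f i) (λ j → w i j * (g i - g j)))) (∑-cong λ j → *-exchange (f i) (w i j) (g i - g j)))
    flip : ∀ i j → w j i * (f j * (g j - g i)) ≡ w i j * (f j * (g j - g i))
    flip i j = cong (_* (f j * (g j - g i))) (w-sym j i)

  0≤𝓔-term : ∀ (f : Fin n → ℚ) i j → 0ℚ ≤ w i j * ((f i - f j) * (f i - f j))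
  0≤𝓔-term f i j = 0≤* (0≤w i j) (0≤sq (f i - f j))

  0≤𝓔 : ∀ f → 0ℚ ≤ 𝓔 f f
  0≤𝓔 f = 0≤∑ λ i → 0≤∑ (0≤𝓔-term f i)

  ∑-Lap : ∀ f → ∑ (Lap f) ≡ 0ℚ
  ∑-Lap f = *≡0 {p = 2ℚ} (λ ()) (begin
    2ℚ * ∑ (Lap f)
      ≡⟨ cong (2ℚ *_) (∑-cong λ i → sym (ℚ.*-identityˡ (Lap f i))) ⟩
    2ℚ * ∑ (λ i → 1ℚ * Lap f i) ≡⟨ green (λ _ → 1ℚ) f ⟩
    𝓔 (λ _ → 1ℚ) f                ≡⟨ ∑∑-cong (λ i j → vanish (w i j) (f i - f j)) ⟩
    ∑∑ {n} (λ _ _ → 0ℚ)          ≡⟨ ∑-≡0 (λ _ → ∑-0 n) ⟩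
    0ℚ                             ∎)
    where
    open ≡-Reasoning
    vanish : ∀ a b → a * ((1ℚ - 1ℚ) * b) ≡ 0ℚ
    vanish = solve-∀ ℚ-ring

  module _ (connected : Connected G) where

    𝓔≡0⇒constant : ∀ (f : Fin n → ℚ) → 𝓔 f f ≡ 0ℚ → ∀ i j → f i ≡ f j
    𝓔≡0⇒constant f 𝓔≡0 i j = along (connected i j)
      where
      across : ∀ {i j} → Edge G i j → f i ≡ f j
      across {i} {j} e = -≡0 (sq≡0 (*≡0 {p = w i j} (λ w≡0 → contradiction (trans (sym (edge⇒w≡1 e)) w≡0) λ ())
        (∑≡0⇒≡0 (0≤𝓔-term f i) (∑≡0⇒≡0 (λ i → 0≤∑ (0≤𝓔-term f i)) 𝓔≡0 i) j)))
      along : ∀ {i j} → Star (Edge G) i j → f i ≡ f j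
      along ε⋆       = refl
      along (e ◅ es) = trans (across e) (along es)

    -- Only the products `f i * Lap f i` enter the energy. In this form the lemma also applies to a
    -- function that is harmonic away from one vertex and vanishes there.
    harmonic⇒constant : ∀ (f : Fin n → ℚ) → (∀ i → f i * Lap f i ≡ 0ℚ) → ∀ i j → f i ≡ f j
    harmonic⇒constant f fLf≡0 = 𝓔≡0⇒constant f
      (trans (sym (green f f)) (trans (cong (2ℚ *_) (trans (∑-cong fLf≡0) (∑-0 n))) refl))

    module _ (2≤n : 2 ℕ.≤ n) where

      1≤d : ∀ i → 1ℚ ≤ d i
      1≤d i = from-path (other i 2≤n)
        where
        other : ∀ {n} (i : Fin n) → 2 ℕ.≤ n → ∃[ j ] i ≢ j
        other {ℕ.suc (ℕ.suc n)} zero    _ = suc zero , λ ()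
        other {ℕ.suc (ℕ.suc n)} (suc i) _ = zero , λ ()
        other {ℕ.suc ℕ.zero} _ (ℕ.s≤s ())
        from-path : ∃[ j ] i ≢ j → 1ℚ ≤ d i
        from-path (j , i≢j) with connected i j
        ... | ε⋆ = contradiction refl i≢j
        ... | _◅_ {j = k} e _ = subst (_≤ d i) (edge⇒w≡1 e) (term≤∑ (0≤w i) k)

      0<d : ∀ i → 0ℚ < d i
      0<d i = ℚ.<-≤-trans (ℚ.positive⁻¹ 1ℚ) (1≤d i)

      0<M : 0ℚ < M
      0<M = ℚ.<-≤-trans (0<d (first 2≤n)) (term≤∑ 0≤d (first 2≤n))
        where
        first : ∀ {n} → 2 ℕ.≤ n → Fin n
        first (ℕ.s≤s _) = zero

-- Limits of rational sequences

infix 4 _⟶_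
record _⟶_ (x : ℕ → ℚ) (s : ℚ) : Set where
  constructor limit
  field
    eventually : ∀ ε → 0ℚ < ε → ∃[ N ] (∀ k → N ℕ.≤ k → ∣ x k - s ∣ < ε)

open _⟶_

½+½ : ∀ p → p ≡ ½ * p + ½ * p
½+½ = solve-∀ ℚ-ring

0<½* : 0ℚ < p → 0ℚ < ½ * p
0<½* = 0<* (ℚ.positive⁻¹ ½)

⟶-cong : {x y : ℕ → ℚ} → (∀ k → x k ≡ y k) → x ⟶ p → y ⟶ p
⟶-cong x≡y x⟶p .eventually ε 0<ε with x⟶p .eventually ε 0<ε
... | N , close = N , λ k N≤k → subst (λ z → ∣ z - _ ∣ < ε) (x≡y k) (close k N≤k)

⟶-const : ∀ p → (λ _ → p) ⟶ p
⟶-const p .eventually ε 0<ε = 0 , λ _ _ → subst (λ z → ∣ z ∣ < ε) (sym (ℚ.+-inverseʳ p)) 0<ε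

⟶-suc : {x : ℕ → ℚ} → x ⟶ p → (x ∘ ℕ.suc) ⟶ p
⟶-suc x⟶p .eventually ε 0<ε with x⟶p .eventually ε 0<ε
... | N , close = N , λ k N≤k → close (ℕ.suc k) (ℕ.m≤n⇒m≤1+n N≤k)

⟶-+ : {x y : ℕ → ℚ} → x ⟶ p → y ⟶ q → (λ k → x k + y k) ⟶ p + q
⟶-+ {p} {q} {x} {y} x⟶p y⟶q .eventually ε 0<ε
  with x⟶p .eventually (½ * ε) (0<½* 0<ε) | y⟶q .eventually (½ * ε) (0<½* 0<ε)
... | N₁ , close₁ | N₂ , close₂ = N₁ ℕ.⊔ N₂ , λ k N≤k → begin-strict
  ∣ x k + y k - (p + q) ∣           ≡⟨ cong ∣_∣ (regroup (x k) (y k) p q) ⟩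
  ∣ (x k - p) + (y k - q) ∣         ≤⟨ ℚ.∣p+q∣≤∣p∣+∣q∣ (x k - p) (y k - q) ⟩
  ∣ x k - p ∣ + ∣ y k - q ∣         <⟨ ℚ.+-mono-<
                                        (close₁ k (ℕ.≤-trans (ℕ.m≤m⊔n N₁ N₂) N≤k))
                                        (close₂ k (ℕ.≤-trans (ℕ.m≤n⊔m N₁ N₂) N≤k)) ⟩
  ½ * ε + ½ * ε                     ≡⟨ sym (½+½ ε) ⟩
  ε                                 ∎
  where
  open ≤-Reasoning
  regroup : ∀ a b c d → a + b - (c + d) ≡ (a - c) + (b - d)
  regroup = solve-∀ ℚ-ring

⟶-* : ∀ c {x : ℕ → ℚ} → x ⟶ p → (λ k → c * x k) ⟶ c * p
⟶-* {p} c {x} x⟶p .eventually ε 0<ε = proj₁ (x⟶p .eventually ε′ 0<ε′) , λ k N≤k → begin-strict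
  ∣ c * x k - c * p ∣  ≡⟨ cong ∣_∣ (*-factorˡ c (x k) p) ⟩
  ∣ c * (x k - p) ∣    ≡⟨ ℚ.∣p*q∣≡∣p∣*∣q∣ c (x k - p) ⟩
  ∣ c ∣ * ∣ x k - p ∣  ≤⟨ ≤-by ∣ x k - p ∣ (ℚ.0≤∣p∣ (x k - p)) (distrib ∣ c ∣ ∣ x k - p ∣) ⟩
  b * ∣ x k - p ∣      <⟨ ℚ.*-monoʳ-<-pos b {{positive 0<b}} (proj₂ (x⟶p .eventually ε′ 0<ε′) k N≤k) ⟩
  b * ε′               ≡⟨ ÷₀-* ε (0<⇒≢0 0<b) ⟩
  ε                    ∎
  where
  open ≤-Reasoning
  -- The added `1ℚ` keeps the divisor of `ε` positive when `c` is zero.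
  b = ∣ c ∣ + 1ℚ
  0<b : 0ℚ < b
  0<b = ℚ.+-mono-≤-< (ℚ.0≤∣p∣ c) (ℚ.positive⁻¹ 1ℚ)
  ε′ = ε ÷₀ b
  0<ε′ : 0ℚ < ε′
  0<ε′ = ℚ.*-cancelˡ-<-nonNeg b {{nonNegative (ℚ.<⇒≤ 0<b)}}
    (subst (b * 0ℚ <_) (sym (÷₀-* ε (0<⇒≢0 0<b)))
      (subst (_< ε) (sym (ℚ.*-zeroʳ b)) 0<ε))
  distrib : ∀ a b → (a + 1ℚ) * b ≡ a * b + b
  distrib = solve-∀ ℚ-ring

⟶-∑ : {x : Fin n → ℕ → ℚ} {s : Fin n → ℚ} → (∀ i → x i ⟶ s i) →
      (λ k → ∑ (λ i → x i k)) ⟶ ∑ s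
⟶-∑ {ℕ.zero}  {x} {s} x⟶s = subst (_ ⟶_) (sym (∑-zero s))
  (⟶-cong (λ k → sym (∑-zero (λ i → x i k))) (⟶-const 0ℚ))
⟶-∑ {ℕ.suc n} {x} {s} x⟶s = subst (_ ⟶_) (sym (∑-suc s))
  (⟶-cong (λ k → sym (∑-suc (λ i → x i k)))
    (⟶-+ (x⟶s zero) (⟶-∑ (x⟶s ∘ suc))))

⟶-unique : {x : ℕ → ℚ} → x ⟶ p → x ⟶ q → p ≡ q
⟶-unique {p} {q} {x} x⟶p x⟶q with p - q ℚ.≟ 0ℚ
... | yes p-q≡0 = -≡0 p-q≡0
... | no  p-q≢0 = contradiction D<D (ℚ.<-irrefl refl)
  where
  open ≤-Reasoning
  D = ∣ p - q ∣
  0<D : 0ℚ < D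
  0<D = ℚ.≰⇒> λ D≤0 → p-q≢0 (ℚ.∣p∣≡0⇒p≡0 (p - q) (ℚ.≤-antisym D≤0 (ℚ.0≤∣p∣ (p - q))))
  N₁ = proj₁ (x⟶p .eventually (½ * D) (0<½* 0<D))
  N₂ = proj₁ (x⟶q .eventually (½ * D) (0<½* 0<D))
  k = N₁ ℕ.⊔ N₂
  via : ∀ a b c → a - b ≡ - (c - a) + (c - b)
  via = solve-∀ ℚ-ring
  D<D : D < D
  D<D = begin-strict
    ∣ p - q ∣                      ≡⟨ cong ∣_∣ (via p q (x k)) ⟩
    ∣ - (x k - p) + (x k - q) ∣    ≤⟨ ℚ.∣p+q∣≤∣p∣+∣q∣ (- (x k - p)) (x k - q) ⟩
    ∣ - (x k - p) ∣ + ∣ x k - q ∣  ≡⟨ cong (_+ ∣ x k - q ∣) (ℚ.∣-p∣≡∣p∣ (x k - p)) ⟩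
    ∣ x k - p ∣ + ∣ x k - q ∣      <⟨ ℚ.+-mono-<
                                       (proj₂ (x⟶p .eventually (½ * D) (0<½* 0<D)) k (ℕ.m≤m⊔n N₁ N₂))
                                       (proj₂ (x⟶q .eventually (½ * D) (0<½* 0<D)) k (ℕ.m≤n⊔m N₁ N₂)) ⟩
    ½ * D + ½ * D                  ≡⟨ sym (½+½ D) ⟩
    D                              ∎

-- First passage times

∑< : ℕ → (ℕ → ℚ) → ℚ
∑< N a = ∑ {N} λ t → a (toℕ t)

∑<-suc : ∀ N a → ∑< (ℕ.suc N) a ≡ a 0 + ∑< N (a ∘ ℕ.suc)
∑<-suc N a = ∑-suc (λ t → a (toℕ t))

∑<-∑ : ∀ N (c : Fin n → ℚ) (x : ℕ → Fin n → ℚ) →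
       ∑< N (λ t → ∑ λ k → c k * x t k) ≡ ∑ (λ k → c k * ∑< N (λ t → x t k))
∑<-∑ N c x = trans (∑-swap (λ t k → c k * x (toℕ t) k))
  (∑-cong λ k → ∑-*ˡ (c k) (λ t → x (toℕ t) k))

module FirstPassage (P : Fin n → Fin n → ℚ) (i : Fin n) where

  Q : Fin n → Fin n → ℚ
  Q j k = P j k * (1ℚ - δ k i)

  f : ℕ → Fin n → ℚ
  f t j = firstPassage P t j i

  -- The probability of, and the truncated mean on, the event T < N.
  F E : ℕ → Fin n → ℚ
  F N j = ∑< N λ t → f t j
  E N j = ∑< N λ t → fromℕ t * f t j

  -- The case distinction of the recursion becomes multiplication by `Q`, the transition matrix with
  -- steps onto `i` suppressed. It starts at time 2, as the value at time 1 is `P j i`.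
  f-step : ∀ t j → f (2 ℕ.+ t) j ≡ ∑ λ k → Q j k * f (1 ℕ.+ t) k
  f-step t j = trans (sym (∑≡sumℚ _)) (∑-cong avoid)
    where
    taboo : ∀ p q → p * (1ℚ - 0ℚ) * q ≡ p * q
    taboo = solve-∀ ℚ-ring
    hit : ∀ p q → p * (1ℚ - 1ℚ) * q ≡ 0ℚ
    hit = solve-∀ ℚ-ring
    avoid : ∀ k → (if does (k ≟ i) then 0ℚ else P j k * f (1 ℕ.+ t) k) ≡ Q j k * f (1 ℕ.+ t) k
    avoid k with does (k ≟ i)
    ... | true  = sym (hit (P j k) (f (1 ℕ.+ t) k))
    ... | false = sym (taboo (P j k) (f (1 ℕ.+ t) k))

  F-step : ∀ N j → F (2 ℕ.+ N) j ≡ P j i + ∑ λ k → Q j k * F (1 ℕ.+ N) k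
  F-step N j = begin
    F (2 ℕ.+ N) j
      ≡⟨ trans (∑<-suc (1 ℕ.+ N) (λ t → f t j)) (ℚ.+-identityˡ _) ⟩
    ∑< (1 ℕ.+ N) (λ t → f (1 ℕ.+ t) j)
      ≡⟨ ∑<-suc N (λ t → f (1 ℕ.+ t) j) ⟩
    P j i + ∑< N (λ t → f (2 ℕ.+ t) j)
      ≡⟨ cong (P j i +_) (trans (∑-cong {N} λ t → f-step (toℕ t) j)
           (∑<-∑ N (Q j) (λ t → f (1 ℕ.+ t)))) ⟩
    P j i + ∑ (λ k → Q j k * ∑< N (λ t → f (1 ℕ.+ t) k))
      ≡⟨ cong (P j i +_) (∑-cong λ k → cong (Q j k *_)
           (sym (trans (∑<-suc N (λ t → f t k)) (ℚ.+-identityˡ _)))) ⟩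
    P j i + ∑ (λ k → Q j k * F (1 ℕ.+ N) k) ∎
    where open ≡-Reasoning

  -- The weight of time `2 + t` is split as one plus `1 + t`: the ones add up to the mass `F`, and
  -- the rest is the truncated mean counted from the first step.
  E-step : ∀ N j → E (2 ℕ.+ N) j ≡ F (2 ℕ.+ N) j + ∑ λ k → Q j k * E (1 ℕ.+ N) k
  E-step N j = begin
    E (2 ℕ.+ N) j
      ≡⟨ trans (∑<-suc (1 ℕ.+ N) (λ t → fromℕ t * f t j))
           (trans (ℚ.+-identityˡ _) (∑<-suc N (λ t → fromℕ (1 ℕ.+ t) * f (1 ℕ.+ t) j))) ⟩
    1ℚ * P j i + ∑< N (λ t → fromℕ (2 ℕ.+ t) * f (2 ℕ.+ t) j)
      ≡⟨ cong₂ _+_ (ℚ.*-identityˡ (P j i))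
           (trans (∑-cong {N} λ t → split (toℕ t)) (∑-+ {N} _ _)) ⟩
    P j i + (F₂ + ∑< N (λ t → ∑ λ k → Q j k * (fromℕ (1 ℕ.+ t) * f (1 ℕ.+ t) k)))
      ≡⟨ sym (ℚ.+-assoc (P j i) F₂ _) ⟩
    P j i + F₂ + ∑< N (λ t → ∑ λ k → Q j k * (fromℕ (1 ℕ.+ t) * f (1 ℕ.+ t) k))
      ≡⟨ cong₂ _+_ (sym F≡) (trans (∑<-∑ N (Q j) (λ t k → fromℕ (1 ℕ.+ t) * f (1 ℕ.+ t) k))
           (∑-cong λ k → cong (Q j k *_)
             (sym (trans (∑<-suc N (λ t → fromℕ t * f t k)) (ℚ.+-identityˡ _))))) ⟩
    F (2 ℕ.+ N) j + ∑ (λ k → Q j k * E (1 ℕ.+ N) k) ∎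
    where
    open ≡-Reasoning
    F₂ = ∑< N (λ t → f (2 ℕ.+ t) j)
    F≡ : F (2 ℕ.+ N) j ≡ P j i + F₂
    F≡ = trans (∑<-suc (1 ℕ.+ N) (λ t → f t j))
      (trans (ℚ.+-identityˡ _) (∑<-suc N (λ t → f (1 ℕ.+ t) j)))
    distrib : ∀ a b → (1ℚ + a) * b ≡ b + a * b
    distrib = solve-∀ ℚ-ring
    split : ∀ t → fromℕ (2 ℕ.+ t) * f (2 ℕ.+ t) j ≡
      f (2 ℕ.+ t) j + ∑ λ k → Q j k * (fromℕ (1 ℕ.+ t) * f (1 ℕ.+ t) k)
    split t = begin
      fromℕ (2 ℕ.+ t) * f (2 ℕ.+ t) j
        ≡⟨ cong (_* f (2 ℕ.+ t) j) (fromℕ-+ 1 (1 ℕ.+ t)) ⟩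
      (1ℚ + fromℕ (1 ℕ.+ t)) * f (2 ℕ.+ t) j
        ≡⟨ distrib (fromℕ (1 ℕ.+ t)) (f (2 ℕ.+ t) j) ⟩
      f (2 ℕ.+ t) j + fromℕ (1 ℕ.+ t) * f (2 ℕ.+ t) j
        ≡⟨ cong (λ z → f (2 ℕ.+ t) j + fromℕ (1 ℕ.+ t) * z) (f-step t j) ⟩
      f (2 ℕ.+ t) j + fromℕ (1 ℕ.+ t) * ∑ (λ k → Q j k * f (1 ℕ.+ t) k)
        ≡⟨ cong (f (2 ℕ.+ t) j +_) (trans (sym (∑-*ˡ (fromℕ (1 ℕ.+ t)) _))
             (∑-cong λ k → *-exchange (fromℕ (1 ℕ.+ t)) (Q j k) (f (1 ℕ.+ t) k))) ⟩
      f (2 ℕ.+ t) j + ∑ (λ k → Q j k * (fromℕ (1 ℕ.+ t) * f (1 ℕ.+ t) k)) ∎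

  -- Convergence of the mean forces the total mass to converge, to this value.
  mass : (Fin n → ℚ) → Fin n → ℚ
  mass m j = m j - ∑ λ k → Q j k * m k

  -- By `E-step` the mass is a difference of truncated means, so it converges to `mass m`. Passing
  -- to the limit in `F-step` gives the equation.
  mass-step : ∀ m → (∀ j → SumsTo (λ t → fromℕ t * f t j) (m j)) →
              ∀ j → mass m j ≡ P j i + ∑ λ k → Q j k * mass m k
  mass-step m sums j = ⟶-unique {x = λ N → F (3 ℕ.+ N) j} (⟶-suc (F⟶ j))
    (⟶-cong (λ N → sym (F-step (1 ℕ.+ N) j))
      (⟶-+ (⟶-const (P j i)) (⟶-∑ λ k → ⟶-* (Q j k) (F⟶ k))))
    where
    E⟶ : ∀ j → (λ N → E N j) ⟶ m j
    E⟶ j = ⟶-cong (λ N → sym (∑≡sumℚ {N} _)) (limit (sums j))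
    isolate : ∀ a b → a ≡ a + b + - 1ℚ * b
    isolate = solve-∀ ℚ-ring
    minus : ∀ a b → a + - 1ℚ * b ≡ a - b
    minus = solve-∀ ℚ-ring
    F⟶ : ∀ j → (λ N → F (2 ℕ.+ N) j) ⟶ mass m j
    F⟶ j = subst (_ ⟶_) (minus (m j) (∑ λ k → Q j k * m k)) (⟶-cong
      (λ N → trans (cong (_+ - 1ℚ * ∑ (λ k → Q j k * E (1 ℕ.+ N) k)) (E-step N j))
        (sym (isolate (F (2 ℕ.+ N) j) (∑ λ k → Q j k * E (1 ℕ.+ N) k))))
      (⟶-+ (⟶-suc (⟶-suc (E⟶ j)))
        (⟶-* (- 1ℚ) (⟶-∑ λ k → ⟶-* (Q j k) (⟶-suc (E⟶ k))))))

-- Hitting times and Kemeny's constant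

-- The interface between the random walk and the energy estimates. In `h i j` the target `i` comes
-- first, opposite to `m j i`, so that `h i` is a potential on the vertices.
record HittingTimes (G : Graph n) (K : ℚ) : Set where
  open Network G
  field
    h        : Fin n → Fin n → ℚ
    h-target : ∀ i → h i i ≡ 0ℚ
    Lap-h    : ∀ i j → Lap (h i) j ≡ d j - δ j i * M
    average  : ∀ j → ∑ (λ i → d i * h i j) ≡ M * K

  energy : ∀ i → 𝓔 (h i) (h i) ≡ 2ℚ * (d ∙ h i)
  energy i = trans (sym (green (h i) (h i))) (cong (2ℚ *_) (begin
    h i ∙ Lap (h i)
      ≡⟨ ∑-cong (λ j → trans (cong (h i j *_) (Lap-h i j)) (expand (h i j) (d j) (δ j i) M)) ⟩
    ∑ (λ j → d j * h i j - M * (δ j i * h i j))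
      ≡⟨ ∑-sub (λ j → d j * h i j) (λ j → M * (δ j i * h i j)) ⟩
    d ∙ h i - ∑ (λ j → M * (δ j i * h i j))
      ≡⟨ cong (λ z → d ∙ h i - z) (trans (∑-*ˡ M (λ j → δ j i * h i j))
           (cong (M *_) (trans (∑-δ i (h i)) (h-target i)))) ⟩
    d ∙ h i - M * 0ℚ
      ≡⟨ drop (d ∙ h i) M ⟩
    d ∙ h i ∎))
    where
    open ≡-Reasoning
    expand : ∀ a b c m → a * (b - c * m) ≡ b * a - m * (c * a)
    expand = solve-∀ ℚ-ring
    drop : ∀ a m → a - m * 0ℚ ≡ a
    drop = solve-∀ ℚ-ring

  0≤d∙h : ∀ i → 0ℚ ≤ d ∙ h i
  0≤d∙h i = *-cancelˡ-≤ (ℚ.positive⁻¹ 2ℚ) (subst (2ℚ * 0ℚ ≤_) (energy i) (0≤𝓔 (h i)))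

module Kemeny (G : Graph n) (connected : Connected G) (2≤n : 2 ℕ.≤ n) where

  open Network G

  P : Fin n → Fin n → ℚ
  P = transition G

  d≢0 : ∀ i → d i ≢ 0ℚ
  d≢0 i = 0<⇒≢0 (0<d connected 2≤n i)

  d*P : ∀ i j → d i * P i j ≡ w i j
  d*P i j = subst (λ x → x * P i j ≡ w i j) (degree≡d i)
    (trans (÷₀-* (fromℕ (adjacency G i j)) (d≢0 i ∘ trans (sym (degree≡d i)))) (adjacency≡w i j))

  d*∑P : ∀ i (x : Fin n → ℚ) → d i * ∑ (λ j → P i j * x j) ≡ ∑ (λ j → w i j * x j)
  d*∑P i x = trans (sym (∑-*ˡ (d i) (λ j → P i j * x j)))
    (∑-cong λ j → trans (sym (ℚ.*-assoc (d i) (P i j) (x j))) (cong (_* x j) (d*P i j)))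

  ∑P≡1 : ∀ i → ∑ (P i) ≡ 1ℚ
  ∑P≡1 i = *-cancelˡ (d≢0 i) (begin
    d i * ∑ (P i)           ≡⟨ sym (∑-*ˡ (d i) (P i)) ⟩
    ∑ (λ j → d i * P i j)   ≡⟨ ∑-cong (d*P i) ⟩
    d i                     ≡⟨ sym (ℚ.*-identityʳ (d i)) ⟩
    d i * 1ℚ                ∎)
    where open ≡-Reasoning

  avoiding : Fin n → (Fin n → ℚ) → Fin n → ℚ
  avoiding i x j = (1ℚ - δ j i) * x j

  avoiding-target : ∀ i (x : Fin n → ℚ) → avoiding i x i ≡ 0ℚ
  avoiding-target i x = trans (cong (λ z → (1ℚ - z) * x i) (δ-refl i)) (ℚ.*-zeroˡ (x i))

  module _ (i : Fin n) where

    open FirstPassage P i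

    d*∑Q : ∀ j (x : Fin n → ℚ) → d j * ∑ (λ k → Q j k * x k) ≡ ∑ (λ k → w j k * avoiding i x k)
    d*∑Q j x = trans (cong (d j *_) (∑-cong λ k → ℚ.*-assoc (P j k) (1ℚ - δ k i) (x k)))
      (d*∑P j (avoiding i x))

    -- Off `i` the function `y` agrees with `x`, so the equation makes it harmonic there; at `i` it
    -- vanishes. Hence `y` has zero energy and is identically zero, and the equation then determines
    -- `x` everywhere, including at `i`.
    taboo⇒0 : ∀ x → (∀ j → x j ≡ ∑ (λ k → Q j k * x k)) → ∀ j → x j ≡ 0ℚ
    taboo⇒0 x x≡Qx j = *≡0 (d≢0 j) (begin
      d j * x j                             ≡⟨ d*x j ⟩
      ∑ (λ k → w j k * avoiding i x k)      ≡⟨ ∑-≡0 (λ k → trans (cong (w j k *_) (vanishes k)) (ℚ.*-zeroʳ (w j k))) ⟩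
      0ℚ                                    ∎)
      where
      open ≡-Reasoning
      y = avoiding i x
      d*x : ∀ j → d j * x j ≡ ∑ (λ k → w j k * y k)
      d*x j = trans (cong (d j *_) (x≡Qx j)) (d*∑Q j x)
      expand : ∀ c a b → c * a * (b * (c * a) - b * a) ≡ c * (c - 1ℚ) * (a * a * b)
      expand = solve-∀ ℚ-ring
      idempotent : ∀ j → (1ℚ - δ j i) * (1ℚ - δ j i - 1ℚ) ≡ 0ℚ
      idempotent j with does (j ≟ i)
      ... | true  = refl
      ... | false = refl
      harmonic : ∀ j → y j * Lap y j ≡ 0ℚ
      harmonic j = begin
        y j * (d j * y j - ∑ (λ k → w j k * y k))
          ≡⟨ cong (λ z → y j * (d j * y j - z)) (sym (d*x j)) ⟩
        y j * (d j * y j - d j * x j)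
          ≡⟨ expand (1ℚ - δ j i) (x j) (d j) ⟩
        (1ℚ - δ j i) * (1ℚ - δ j i - 1ℚ) * (x j * x j * d j)
          ≡⟨ cong (_* (x j * x j * d j)) (idempotent j) ⟩
        0ℚ * (x j * x j * d j)
          ≡⟨ ℚ.*-zeroˡ (x j * x j * d j) ⟩
        0ℚ ∎
      vanishes : ∀ k → y k ≡ 0ℚ
      vanishes k = trans (harmonic⇒constant connected y harmonic k i) (avoiding-target i x)

    P+∑Q≡1 : ∀ j → P j i + ∑ (Q j) ≡ 1ℚ
    P+∑Q≡1 j = begin
      P j i + ∑ (Q j)
        ≡⟨ cong (P j i +_) (trans (∑-cong λ k → expand (P j k) (δ k i))
             (trans (∑-sub (P j) (λ k → δ k i * P j k)) (cong₂ _-_ (∑P≡1 j) (∑-δ i (P j))))) ⟩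
      P j i + (1ℚ - P j i) ≡⟨ cancel (P j i) ⟩
      1ℚ ∎
      where
      open ≡-Reasoning
      expand : ∀ a b → a * (1ℚ - b) ≡ a - b * a
      expand = solve-∀ ℚ-ring
      cancel : ∀ a → a + (1ℚ - a) ≡ 1ℚ
      cancel = solve-∀ ℚ-ring

    -- Summability of the means gives the equation of mass-step, whose only
    -- solution is 1: the chain is recurrent.
    first-step : ∀ m → (∀ j → SumsTo (λ t → fromℕ t * f t j) (m j)) →
                 ∀ j → m j ≡ 1ℚ + ∑ (λ k → Q j k * m k)
    first-step m sums j = begin
      m j                                 ≡⟨ isolate (m j) (∑ λ k → Q j k * m k) ⟩
      1ℚ + ∑ (λ k → Q j k * m k) - (1ℚ - mass m j)
        ≡⟨ cong (λ z → 1ℚ + ∑ (λ k → Q j k * m k) - z) (taboo⇒0 (λ j → 1ℚ - mass m j) defect j) ⟩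
      1ℚ + ∑ (λ k → Q j k * m k) - 0ℚ     ≡⟨ ℚ.+-identityʳ _ ⟩
      1ℚ + ∑ (λ k → Q j k * m k)          ∎
      where
      open ≡-Reasoning
      isolate : ∀ a b → a ≡ 1ℚ + b - (1ℚ - (a - b))
      isolate = solve-∀ ℚ-ring
      regroup : ∀ a b c → a + b - (a + c) ≡ b - c
      regroup = solve-∀ ℚ-ring
      factor : ∀ a b → a - a * b ≡ a * (1ℚ - b)
      factor = solve-∀ ℚ-ring
      defect : ∀ j → 1ℚ - mass m j ≡ ∑ (λ k → Q j k * (1ℚ - mass m k))
      defect j = begin
        1ℚ - mass m j
          ≡⟨ cong₂ _-_ (sym (P+∑Q≡1 j)) (mass-step m sums j) ⟩
        P j i + ∑ (Q j) - (P j i + ∑ (λ k → Q j k * mass m k))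
          ≡⟨ regroup (P j i) (∑ (Q j)) (∑ λ k → Q j k * mass m k) ⟩
        ∑ (Q j) - ∑ (λ k → Q j k * mass m k)
          ≡⟨ sym (∑-sub (Q j) (λ k → Q j k * mass m k)) ⟩
        ∑ (λ k → Q j k - Q j k * mass m k)
          ≡⟨ ∑-cong (λ k → factor (Q j k) (mass m k)) ⟩
        ∑ (λ k → Q j k * (1ℚ - mass m k)) ∎

  -- By reversibility the density `π i / d i` is harmonic, hence constant, and normalisation makes
  -- the constant `1 / M`.
  stationary≡d : ∀ {π} → IsStationary P π → ∀ i → M * π i ≡ d i
  stationary≡d {π} st i = begin
    M * π i                      ≡⟨ cong (M *_) (sym (d*ρ i)) ⟩
    M * (d i * ρ i)              ≡⟨ *-exchange M (d i) (ρ i) ⟩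
    d i * (M * ρ i)              ≡⟨ cong (d i *_) M*ρ ⟩
    d i * 1ℚ                     ≡⟨ ℚ.*-identityʳ (d i) ⟩
    d i                          ∎
    where
    open ≡-Reasoning
    open IsStationary st
    ρ : Fin n → ℚ
    ρ i = π i ÷₀ d i
    d*ρ : ∀ i → d i * ρ i ≡ π i
    d*ρ i = ÷₀-* (π i) (d≢0 i)
    swap : ∀ a b c → a * b * c ≡ a * c * b
    swap = solve-∀ ℚ-ring
    flow : ∀ j → ∑ (λ i → w j i * ρ i) ≡ d j * ρ j
    flow j = begin
      ∑ (λ i → w j i * ρ i)           ≡⟨ ∑-cong (λ i → cong (_* ρ i) (trans (w-sym j i) (sym (d*P i j)))) ⟩
      ∑ (λ i → d i * P i j * ρ i)     ≡⟨ ∑-cong (λ i → trans (swap (d i) (P i j) (ρ i)) (cong (_* P i j) (d*ρ i))) ⟩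
      ∑ (λ i → π i * P i j)           ≡⟨ trans (∑≡sumℚ _) (invariant j) ⟩
      π j                             ≡⟨ sym (d*ρ j) ⟩
      d j * ρ j                       ∎
    harmonic : ∀ j → ρ j * Lap ρ j ≡ 0ℚ
    harmonic j = trans (cong (ρ j *_) (trans (cong (λ z → d j * ρ j - z) (flow j)) (ℚ.+-inverseʳ (d j * ρ j))))
      (ℚ.*-zeroʳ (ρ j))
    M*ρ : M * ρ i ≡ 1ℚ
    M*ρ = begin
      M * ρ i                   ≡⟨ sym (∑-*ʳ (ρ i) d) ⟩
      ∑ (λ j → d j * ρ i)       ≡⟨ ∑-cong (λ j → trans (cong (d j *_) (harmonic⇒constant connected ρ harmonic i j)) (d*ρ j)) ⟩
      ∑ π                       ≡⟨ trans (∑≡sumℚ π) normalised ⟩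
      1ℚ                        ∎

  Lap-∑ : ∀ (c : Fin n → ℚ) (x : Fin n → Fin n → ℚ) j →
          Lap (λ k → ∑ (λ i → c i * x i k)) j ≡ ∑ (λ i → c i * Lap (x i) j)
  Lap-∑ c x j = begin
    d j * ∑ (λ i → c i * x i j) - ∑ (λ k → w j k * ∑ (λ i → c i * x i k))
      ≡⟨ cong₂ _-_ (pull (d j) j) (trans (∑-cong λ k → pull (w j k) k)
           (trans (∑-swap (λ k i → c i * (w j k * x i k)))
             (∑-cong λ i → ∑-*ˡ (c i) (λ k → w j k * x i k)))) ⟩
    ∑ (λ i → c i * (d j * x i j)) - ∑ (λ i → c i * ∑ (λ k → w j k * x i k))
      ≡⟨ sym (∑-sub (λ i → c i * (d j * x i j)) (λ i → c i * ∑ (λ k → w j k * x i k))) ⟩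
    ∑ (λ i → c i * (d j * x i j) - c i * ∑ (λ k → w j k * x i k))
      ≡⟨ ∑-cong (λ i → *-factorˡ (c i) (d j * x i j) (∑ (λ k → w j k * x i k))) ⟩
    ∑ (λ i → c i * Lap (x i) j) ∎
    where
    open ≡-Reasoning
    pull : ∀ a k → a * ∑ (λ i → c i * x i k) ≡ ∑ (λ i → c i * (a * x i k))
    pull a k = trans (sym (∑-*ˡ a (λ i → c i * x i k))) (∑-cong λ i → *-exchange a (c i) (x i k))

  hittingTimes : ∀ {K} → IsKemeny G K → HittingTimes G K
  hittingTimes {K} kem = record
    { h        = h
    ; h-target = λ i → avoiding-target i (λ j → m j i)
    ; Lap-h    = Lap-h
    ; average  = λ j → trans (independent j) average-start
    }
    where
    open ≡-Reasoning
    open IsKemeny kem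
    h : Fin n → Fin n → ℚ
    h i = avoiding i (λ j → m j i)
    d*m : ∀ i j → d j * m j i ≡ d j + ∑ (λ k → w j k * h i k)
    d*m i j = begin
      d j * m j i   ≡⟨ cong (d j *_) (first-step i (λ j → m j i) (λ j → meanFirstPassage j i) j) ⟩
      d j * (1ℚ + ∑ (λ k → FirstPassage.Q P i j k * m k i))
                    ≡⟨ distrib (d j) (∑ (λ k → FirstPassage.Q P i j k * m k i)) ⟩
      d j + d j * ∑ (λ k → FirstPassage.Q P i j k * m k i)
                    ≡⟨ cong (d j +_) (d*∑Q i j (λ k → m k i)) ⟩
      d j + ∑ (λ k → w j k * h i k) ∎
      where
      distrib : ∀ a b → a * (1ℚ + b) ≡ a + a * b
      distrib = solve-∀ ℚ-ring
    Lap-h′ : ∀ i j → Lap (h i) j ≡ d j - δ j i * (d j * m j i)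
    Lap-h′ i j = begin
      d j * h i j - ∑ (λ k → w j k * h i k)
        ≡⟨ regroup (d j) (δ j i) (m j i) (∑ (λ k → w j k * h i k)) ⟩
      d j * m j i - ∑ (λ k → w j k * h i k) - δ j i * (d j * m j i)
        ≡⟨ cong (λ z → z - ∑ (λ k → w j k * h i k) - δ j i * (d j * m j i)) (d*m i j) ⟩
      d j + ∑ (λ k → w j k * h i k) - ∑ (λ k → w j k * h i k) - δ j i * (d j * m j i)
        ≡⟨ cong (_- δ j i * (d j * m j i)) (cancel (d j) (∑ (λ k → w j k * h i k))) ⟩
      d j - δ j i * (d j * m j i) ∎
      where
      regroup : ∀ a b c s → a * ((1ℚ - b) * c) - s ≡ a * c - s - b * (a * c)
      regroup = solve-∀ ℚ-ring
      cancel : ∀ a s → a + s - s ≡ a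
      cancel = solve-∀ ℚ-ring
    -- Kac's formula. Summing `Lap-h′ i` over all vertices gives zero on the left by `∑-Lap`; on the
    -- right only `M` and the diagonal term survive.
    return : ∀ i → d i * m i i ≡ M
    return i = sym (-≡0 (begin
      M - d i * m i i
        ≡⟨ cong (λ z → M - z) (sym (∑-δ i (λ j → d j * m j i))) ⟩
      M - ∑ (λ j → δ j i * (d j * m j i))
        ≡⟨ sym (∑-sub d (λ j → δ j i * (d j * m j i))) ⟩
      ∑ (λ j → d j - δ j i * (d j * m j i))
        ≡⟨ ∑-cong (λ j → sym (Lap-h′ i j)) ⟩
      ∑ (Lap (h i))
        ≡⟨ ∑-Lap (h i) ⟩
      0ℚ ∎))
    at-target : ∀ i j → δ j i * (d j * m j i) ≡ δ j i * M
    at-target i j with j ≟ i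
    ... | yes refl = cong (1ℚ *_) (return i)
    ... | no  _    = trans (ℚ.*-zeroˡ (d j * m j i)) (sym (ℚ.*-zeroˡ M))
    Lap-h : ∀ i j → Lap (h i) j ≡ d j - δ j i * M
    Lap-h i j = trans (Lap-h′ i j) (cong (λ z → d j - z) (at-target i j))
    S : Fin n → ℚ
    S j = ∑ (λ i → d i * h i j)
    -- The random target lemma. In the sum of `d i * Lap (h i) j` the constant parts contribute
    -- `M * d j` and the point masses take away `d j * M`, so the average over targets is harmonic.
    harmonic : ∀ j → S j * Lap S j ≡ 0ℚ
    harmonic j = trans (cong (S j *_) (begin
      Lap S j                                   ≡⟨ Lap-∑ d h j ⟩
      ∑ (λ i → d i * Lap (h i) j)               ≡⟨ ∑-cong (λ i → trans (cong (d i *_) (Lap-h i j)) (expand (d i) (d j) (δ j i) M)) ⟩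
      ∑ (λ i → d i * d j - δ j i * d i * M)     ≡⟨ ∑-sub (λ i → d i * d j) (λ i → δ j i * d i * M) ⟩
      ∑ (λ i → d i * d j) - ∑ (λ i → δ j i * d i * M)
        ≡⟨ cong₂ _-_ (∑-*ʳ (d j) d) (trans (∑-*ʳ M (λ i → δ j i * d i))
             (cong (_* M) (trans (∑-cong λ i → cong (_* d i) (δ-sym j i)) (∑-δ j d)))) ⟩
      M * d j - d j * M                         ≡⟨ cancel M (d j) ⟩
      0ℚ                                        ∎)) (ℚ.*-zeroʳ (S j))
      where
      expand : ∀ a b c e → a * (b - c * e) ≡ a * b - c * a * e
      expand = solve-∀ ℚ-ring
      cancel : ∀ a b → a * b - b * a ≡ 0ℚ
      cancel = solve-∀ ℚ-ring
    independent : ∀ j → S j ≡ S start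
    independent j = harmonic⇒constant connected S harmonic j start
    -- The `1ℚ` subtracted in `value` is the return term: `M * (π start * m start start)` equals
    -- `M`, and it is missing from `S start` because `h start start` is zero.
    average-start : S start ≡ M * K
    average-start = begin
      S start
        ≡⟨ isolate (S start) M ⟩
      S start + M - M * 1ℚ
        ≡⟨ cong (λ z → z - M * 1ℚ) (begin
             S start + M
               ≡⟨ cong (S start +_) (sym (∑-δ start (λ _ → M))) ⟩
             S start + ∑ (λ i → δ i start * M)
               ≡⟨ sym (∑-+ (λ i → d i * h i start) (λ i → δ i start * M)) ⟩
             ∑ (λ i → d i * h i start + δ i start * M)
               ≡⟨ ∑-cong restore ⟩
             ∑ (λ i → M * (π i * m start i))
               ≡⟨ ∑-*ˡ M (λ i → π i * m start i) ⟩
             M * ∑ (λ i → π i * m start i) ∎) ⟩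
      M * ∑ (λ i → π i * m start i) - M * 1ℚ
        ≡⟨ factor M (∑ (λ i → π i * m start i)) ⟩
      M * (∑ (λ i → π i * m start i) - 1ℚ)
        ≡⟨ cong (M *_) (trans (cong (_- 1ℚ) (∑≡sumℚ _)) (sym value)) ⟩
      M * K ∎
      where
      isolate : ∀ a b → a ≡ a + b - b * 1ℚ
      isolate = solve-∀ ℚ-ring
      factor : ∀ a b → a * b - a * 1ℚ ≡ a * (b - 1ℚ)
      factor = solve-∀ ℚ-ring
      regroup : ∀ a b c → a * ((1ℚ - b) * c) + b * (a * c) ≡ a * c
      regroup = solve-∀ ℚ-ring
      at-start : ∀ i → δ start i * (d i * m start i) ≡ δ start i * M
      at-start i with start ≟ i
      ... | yes refl = cong (1ℚ *_) (return i)
      ... | no  _    = trans (ℚ.*-zeroˡ (d i * m start i)) (sym (ℚ.*-zeroˡ M))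
      restore : ∀ i → d i * h i start + δ i start * M ≡ M * (π i * m start i)
      restore i = begin
        d i * h i start + δ i start * M
          ≡⟨ cong (λ z → d i * h i start + z) (trans (cong (_* M) (δ-sym i start))
               (sym (at-start i))) ⟩
        d i * h i start + δ start i * (d i * m start i)
          ≡⟨ regroup (d i) (δ start i) (m start i) ⟩
        d i * m start i
          ≡⟨ cong (_* m start i) (sym (stationary≡d stationary i)) ⟩
        M * π i * m start i
          ≡⟨ ℚ.*-assoc M (π i) (m start i) ⟩
        M * (π i * m start i) ∎

-- Edge deletion and Rayleigh monotonicity

module _ (G : Graph n) where

  open Network G

  Lap-+ : ∀ (f g : Fin n → ℚ) j → Lap (λ i → f i + g i) j ≡ Lap f j + Lap g j
  Lap-+ f g j = trans (cong (λ z → d j * (f j + g j) - z) (∙-+ʳ (w j) f g))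
    (regroup (d j) (f j) (g j) (w j ∙ f) (w j ∙ g))
    where
    regroup : ∀ a b c x y → a * (b + c) - (x + y) ≡ (a * b - x) + (a * c - y)
    regroup = solve-∀ ℚ-ring

  Lap-* : ∀ c (f : Fin n → ℚ) j → Lap (λ i → c * f i) j ≡ c * Lap f j
  Lap-* c f j = trans (cong (λ z → d j * (c * f j) - z) (∙-*ʳ (w j) c f))
    (regroup (d j) c (f j) (w j ∙ f))
    where
    regroup : ∀ a b c x → a * (b * c) - b * x ≡ b * (a * c - x)
    regroup = solve-∀ ℚ-ring

-- If f and g solve the same Poisson equation on H and on the larger network
-- G, then 𝓔 H (f - g) ≥ 0 compares their energies.
rayleigh : ∀ {n} (G H : Graph n) → (∀ i j → Network.w H i j ≤ Network.w G i j) →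
           ∀ (b f g : Fin n → ℚ) → (∀ j → Network.Lap H f j ≡ b j) →
           (∀ j → Network.Lap G g j ≡ b j) → b ∙ g ≤ b ∙ f
-- The quantity `2ℚ * (b ∙ g)` has two readings: `𝓔G g g` from the equation for `g`, and the mixed
-- form `𝓔H g f` from the equation for `f`. The inequality `cross` relates both to `𝓔H f f`.
rayleigh {n} G H w≤ b f g Lf≡b Lg≡b = *-cancelˡ-≤ (ℚ.positive⁻¹ 2ℚ)
  (≤-by (𝓔H f f + 𝓔G g g - 2ℚ * 𝓔H g f) (≤⇒0≤- cross) (begin
    2ℚ * (b ∙ f)
      ≡⟨ regroup (2ℚ * (b ∙ f)) (2ℚ * (b ∙ g)) ⟩
    2ℚ * (b ∙ g) + (2ℚ * (b ∙ f) + 2ℚ * (b ∙ g) - 2ℚ * (2ℚ * (b ∙ g)))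
      ≡⟨ cong (2ℚ * (b ∙ g) +_) (cong₂ _-_ (cong₂ _+_ (bf f) bg) (cong (2ℚ *_) (bf g))) ⟩
    2ℚ * (b ∙ g) + (𝓔H f f + 𝓔G g g - 2ℚ * 𝓔H g f) ∎))
  where
  open ≡-Reasoning
  open Network G using () renaming (𝓔 to 𝓔G; w to wG)
  open Network H using () renaming (𝓔 to 𝓔H; w to wH)
  regroup : ∀ x y → x ≡ y + (x + y - 2ℚ * y)
  regroup = solve-∀ ℚ-ring
  bf : ∀ x → 2ℚ * (b ∙ x) ≡ 𝓔H x f
  bf x = trans (cong (2ℚ *_) (trans (∙-comm b x) (∙-congʳ x λ j → sym (Lf≡b j)))) (Network.green H x f)
  bg : 2ℚ * (b ∙ g) ≡ 𝓔G g g
  bg = trans (cong (2ℚ *_) (trans (∙-comm b g) (∙-congʳ g λ j → sym (Lg≡b j)))) (Network.green G g g)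
  -- The slack is a completed square with the weight of `H`, plus the surplus weight of `G` times
  -- the square of the difference of `g`.
  pointwise : ∀ i j → 2ℚ * (wH i j * ((g i - g j) * (f i - f j))) ≤
    wH i j * ((f i - f j) * (f i - f j)) + wG i j * ((g i - g j) * (g i - g j))
  pointwise i j = ≤-by
    (wH i j * ((x - y) * (x - y)) + (wG i j - wH i j) * (y * y))
    (0≤+ (0≤* (Network.0≤w H i j) (0≤sq (x - y))) (0≤* (≤⇒0≤- (w≤ i j)) (0≤sq y)))
    (complete (wH i j) (wG i j) x y)
    where
    x = f i - f j
    y = g i - g j
    complete : ∀ a b x y → a * (x * x) + b * (y * y) ≡
      2ℚ * (a * (y * x)) + (a * ((x - y) * (x - y)) + (b - a) * (y * y))
    complete = solve-∀ ℚ-ring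
  cross : 2ℚ * 𝓔H g f ≤ 𝓔H f f + 𝓔G g g
  cross = subst (_≤ 𝓔H f f + 𝓔G g g) (∑∑-* 2ℚ term)
    (subst (∑∑ (λ i j → 2ℚ * term i j) ≤_)
      (∑∑-+ (λ i j → wH i j * ((f i - f j) * (f i - f j)))
            (λ i j → wG i j * ((g i - g j) * (g i - g j))))
      (∑∑-mono pointwise))
    where
    term : Fin n → Fin n → ℚ
    term i j = wH i j * ((g i - g j) * (f i - f j))

module EdgeDeletion (G : Graph n) (u v : Fin n) (e : Edge G u v) where

  private
    H = deleteEdge G u v

  open Network G
  open Network H using ()
    renaming (w to w′; d to d′; M to M′; Lap to Lap′; 0≤d to 0≤d′; 0≤w to 0≤w′)

  u≢v : u ≢ v
  u≢v refl = contradiction (trans (sym e) (loopless G u)) λ ()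

  -- The factor of a product of two `δ`s whose decision is left unmatched, because the other factor
  -- is already `0ℚ`.
  indicator : {A : Set} → Dec A → ℚ
  indicator a? = if does a? then 1ℚ else 0ℚ

  kept : ∀ a {x y} → x ≡ 0ℚ → y ≡ 0ℚ →
    fromℕ (if a then 1 else 0) ≡ fromℕ (if a ∧ true then 1 else 0) + (x + y)
  kept a refl refl rewrite Bool.∧-identityʳ a = sym (ℚ.+-identityʳ _)

  adjacency-deleteEdge : ∀ i j → fromℕ (adjacency G i j) ≡
    fromℕ (adjacency H i j) + (δ i u * δ j v + δ i v * δ j u)
  adjacency-deleteEdge i j with i ≟ u | j ≟ v | i ≟ v | j ≟ u
  ... | yes refl | _        | yes refl | _        = contradiction refl u≢v
  ... | yes refl | yes refl | no _     | q        rewrite e =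
    sym (cong (λ z → 0ℚ + (1ℚ + z)) (ℚ.*-zeroˡ (indicator q)))
  ... | no _     | p        | yes refl | yes refl rewrite trans (symmetric G v u) e =
    sym (cong (λ z → 0ℚ + (z + 1ℚ)) (ℚ.*-zeroˡ (indicator p)))
  ... | yes refl | no _     | no _     | q        = kept (adj G i j) refl (ℚ.*-zeroˡ (indicator q))
  ... | no _     | p        | no _     | q        =
    kept (adj G i j) (ℚ.*-zeroˡ (indicator p)) (ℚ.*-zeroˡ (indicator q))
  ... | no _     | p        | yes refl | no _     = kept (adj G i j) (ℚ.*-zeroˡ (indicator p)) refl

  w≡ : ∀ i j → w i j ≡ w′ i j + (δ i u * δ j v + δ i v * δ j u)
  w≡ i j = trans (sym (adjacency≡w i j)) (trans (adjacency-deleteEdge i j)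
    (cong (_+ (δ i u * δ j v + δ i v * δ j u)) (Network.adjacency≡w H i j)))

  0≤δ : ∀ i j → 0ℚ ≤ δ {n} i j
  0≤δ i j with does (i ≟ j)
  ... | true  = ℚ.<⇒≤ (ℚ.positive⁻¹ 1ℚ)
  ... | false = ℚ.≤-refl

  w′≤w : ∀ i j → w′ i j ≤ w i j
  w′≤w i j = ≤-by _ (0≤+ (0≤* (0≤δ i u) (0≤δ j v)) (0≤* (0≤δ i v) (0≤δ j u))) (w≡ i j)

  d≡ : ∀ i → d i ≡ d′ i + (δ i u + δ i v)
  d≡ i = begin
    ∑ (w i)
      ≡⟨ ∑-cong (w≡ i) ⟩
    ∑ (λ j → w′ i j + (δ i u * δ j v + δ i v * δ j u))
      ≡⟨ trans (∑-+ (w′ i) _) (cong (d′ i +_) (∑-+ (λ j → δ i u * δ j v) (λ j → δ i v * δ j u))) ⟩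
    d′ i + (∑ (λ j → δ i u * δ j v) + ∑ (λ j → δ i v * δ j u))
      ≡⟨ cong (d′ i +_) (cong₂ _+_ (unit (δ i u) v) (unit (δ i v) u)) ⟩
    d′ i + (δ i u + δ i v) ∎
    where
    open ≡-Reasoning
    unit : ∀ c k → ∑ (λ j → c * δ j k) ≡ c
    unit c k = trans (∑-*ˡ c (λ j → δ j k)) (trans (cong (c *_) (∑-δ-1 k)) (ℚ.*-identityʳ c))

  M≡ : M ≡ M′ + 2ℚ
  M≡ = trans (∑-cong d≡) (trans (∑-+ d′ _)
    (cong (M′ +_) (trans (∑-+ (λ i → δ i u) (λ i → δ i v)) (cong₂ _+_ (∑-δ-1 u) (∑-δ-1 v)))))

  module _ {K K′ : ℚ} (hG : HittingTimes G K) (hH : HittingTimes H K′)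
           (0<M : 0ℚ < M) (0<M′ : 0ℚ < M′) where

    open HittingTimes hG
    open HittingTimes hH using ()
      renaming (h to h′; h-target to h′-target; Lap-h to Lap-h′; average to average′)

    -- M * b i is the Laplacian of g i on G and of M * h′ i on the graph
    -- without the edge.
    b g : Fin n → Fin n → ℚ
    b i j = d′ j - δ j i * M′
    g i j = M′ * h i j + (h u j + h v j)

    -- Adding `h u + h v` raises the coefficient of `d` from `M′` to `M`, and the new poles of size
    -- `M` at `u` and `v` turn `M * d` into `M * d′`.
    Lap-g : ∀ i j → Lap (g i) j ≡ M * b i j
    Lap-g i j = begin
      Lap (g i) j
        ≡⟨ trans (Lap-+ G (λ k → M′ * h i k) (λ k → h u k + h v k) j)
             (cong₂ _+_ (Lap-* G M′ (h i) j) (Lap-+ G (h u) (h v) j)) ⟩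
      M′ * Lap (h i) j + (Lap (h u) j + Lap (h v) j)
        ≡⟨ cong₂ _+_ (cong (M′ *_) (Lap-h i j)) (cong₂ _+_ (Lap-h u j) (Lap-h v j)) ⟩
      M′ * (d j - δ j i * M) + (d j - δ j u * M + (d j - δ j v * M))
        ≡⟨ collect M M′ (d j) (δ j i) (δ j u) (δ j v) ⟩
      (M′ + 2ℚ) * d j - M * (δ j u + δ j v + δ j i * M′)
        ≡⟨ cong₂ (λ x y → x * y - M * (δ j u + δ j v + δ j i * M′)) (sym M≡) (d≡ j) ⟩
      M * (d′ j + (δ j u + δ j v)) - M * (δ j u + δ j v + δ j i * M′)
        ≡⟨ cancel M (d′ j) (δ j u + δ j v) (δ j i * M′) ⟩
      M * (d′ j - δ j i * M′) ∎
      where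
      open ≡-Reasoning
      collect : ∀ m m′ x a b c → m′ * (x - a * m) + (x - b * m + (x - c * m)) ≡
        (m′ + 2ℚ) * x - m * (b + c + a * m′)
      collect = solve-∀ ℚ-ring
      cancel : ∀ m x y z → m * (x + y) - m * (y + z) ≡ m * (x - z)
      cancel = solve-∀ ℚ-ring

    b∙ : ∀ i f → b i ∙ f ≡ d′ ∙ f - M′ * f i
    b∙ i f = begin
      ∑ (λ j → (d′ j - δ j i * M′) * f j)
        ≡⟨ ∑-cong (λ j → expand (d′ j) (δ j i) M′ (f j)) ⟩
      ∑ (λ j → d′ j * f j - M′ * (δ j i * f j))
        ≡⟨ ∑-sub (λ j → d′ j * f j) (λ j → M′ * (δ j i * f j)) ⟩
      d′ ∙ f - ∑ (λ j → M′ * (δ j i * f j))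
        ≡⟨ cong (λ z → d′ ∙ f - z) (trans (∑-*ˡ M′ (λ j → δ j i * f j)) (cong (M′ *_) (∑-δ i f))) ⟩
      d′ ∙ f - M′ * f i ∎
      where
      open ≡-Reasoning
      expand : ∀ a b c x → (a - b * c) * x ≡ a * x - c * (b * x)
      expand = solve-∀ ℚ-ring

    d′∙h : ∀ i → d′ ∙ h i ≡ d ∙ h i - (h i u + h i v)
    d′∙h i = begin
      d′ ∙ h i
        ≡⟨ p≡p+q-q (d′ ∙ h i) (h i u + h i v) ⟩
      d′ ∙ h i + (h i u + h i v) - (h i u + h i v)
        ≡⟨ cong (_- (h i u + h i v)) (sym (begin
             d ∙ h i
               ≡⟨ ∑-cong (λ j → cong (_* h i j) (d≡ j)) ⟩
             (λ j → d′ j + (δ j u + δ j v)) ∙ h i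
               ≡⟨ trans (∙-+ˡ d′ (λ j → δ j u + δ j v) (h i))
                    (cong (d′ ∙ h i +_) (∙-+ˡ (λ j → δ j u) (λ j → δ j v) (h i))) ⟩
             d′ ∙ h i + ((λ j → δ j u) ∙ h i + (λ j → δ j v) ∙ h i)
               ≡⟨ cong (d′ ∙ h i +_) (cong₂ _+_ (∑-δ u (h i)) (∑-δ v (h i))) ⟩
             d′ ∙ h i + (h i u + h i v) ∎)) ⟩
      d ∙ h i - (h i u + h i v) ∎
      where
      open ≡-Reasoning

    column : ∀ j → d′ ∙ (λ i → h i j) ≡ M * K - (h u j + h v j)
    column j = begin
      d′ ∙ (λ i → h i j)
        ≡⟨ p≡p+q-q (d′ ∙ (λ i → h i j)) (h u j + h v j) ⟩
      d′ ∙ (λ i → h i j) + (h u j + h v j) - (h u j + h v j)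
        ≡⟨ cong (_- (h u j + h v j)) (sym (begin
             M * K
               ≡⟨ sym (average j) ⟩
             d ∙ (λ i → h i j)
               ≡⟨ ∑-cong (λ i → cong (_* h i j) (d≡ i)) ⟩
             (λ i → d′ i + (δ i u + δ i v)) ∙ (λ i → h i j)
               ≡⟨ trans (∙-+ˡ d′ (λ i → δ i u + δ i v) (λ i → h i j))
                    (cong (d′ ∙ (λ i → h i j) +_) (∙-+ˡ (λ i → δ i u) (λ i → δ i v) (λ i → h i j))) ⟩
             d′ ∙ (λ i → h i j) + ((λ i → δ i u) ∙ (λ i → h i j) + (λ i → δ i v) ∙ (λ i → h i j))
               ≡⟨ cong (d′ ∙ (λ i → h i j) +_) (cong₂ _+_ (∑-δ u (λ i → h i j)) (∑-δ v (λ i → h i j))) ⟩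
             d′ ∙ (λ i → h i j) + (h u j + h v j) ∎)) ⟩
      M * K - (h u j + h v j) ∎
      where
      open ≡-Reasoning

    -- The commute time between `u` and `v`. It is, up to positive factors, the energy of
    -- `h u - h v`, whose Laplacian is supported on the two end points; this gives a sign to the sum
    -- without one for each hitting time.
    0≤h+h : 0ℚ ≤ h u v + h v u
    0≤h+h = *-cancelˡ-≤ 0<M (*-cancelˡ-≤ (ℚ.positive⁻¹ 2ℚ)
      (subst (_≤ 2ℚ * (M * (h u v + h v u))) (sym (zeros M))
        (subst (0ℚ ≤_) (trans (sym (green x x)) (cong (2ℚ *_) x∙Lap-x)) (0≤𝓔 x))))
      where
      open ≡-Reasoning
      x : Fin n → ℚ
      x j = h u j + - 1ℚ * h v j
      zeros : ∀ m → 2ℚ * (m * 0ℚ) ≡ 0ℚ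
      zeros = solve-∀ ℚ-ring
      Lap-x : ∀ j → Lap x j ≡ M * δ j v - M * δ j u
      Lap-x j = begin
        Lap x j
          ≡⟨ trans (Lap-+ G (h u) (λ k → - 1ℚ * h v k) j) (cong (Lap (h u) j +_) (Lap-* G (- 1ℚ) (h v) j)) ⟩
        Lap (h u) j + - 1ℚ * Lap (h v) j
          ≡⟨ cong₂ (λ y z → y + - 1ℚ * z) (Lap-h u j) (Lap-h v j) ⟩
        d j - δ j u * M + - 1ℚ * (d j - δ j v * M)
          ≡⟨ collect (d j) (δ j u) (δ j v) M ⟩
        M * δ j v - M * δ j u ∎
        where
        collect : ∀ a b c m → a - b * m + - 1ℚ * (a - c * m) ≡ m * c - m * b
        collect = solve-∀ ℚ-ring
      x∙Lap-x : x ∙ Lap x ≡ M * (h u v + h v u)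
      x∙Lap-x = begin
        x ∙ Lap x
          ≡⟨ ∑-cong (λ j → trans (cong (x j *_) (Lap-x j)) (expand (x j) M (δ j v) (δ j u))) ⟩
        ∑ (λ j → M * (δ j v * x j) - M * (δ j u * x j))
          ≡⟨ trans (∑-sub (λ j → M * (δ j v * x j)) (λ j → M * (δ j u * x j)))
               (cong₂ _-_ (trans (∑-*ˡ M (λ j → δ j v * x j)) (cong (M *_) (∑-δ v x)))
                          (trans (∑-*ˡ M (λ j → δ j u * x j)) (cong (M *_) (∑-δ u x)))) ⟩
        M * (h u v + - 1ℚ * h v v) - M * (h u u + - 1ℚ * h v u)
          ≡⟨ cong₂ (λ y z → M * (h u v + - 1ℚ * y) - M * (z + - 1ℚ * h v u)) (h-target v) (h-target u) ⟩
        M * (h u v + - 1ℚ * 0ℚ) - M * (0ℚ + - 1ℚ * h v u)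
          ≡⟨ collect M (h u v) (h v u) ⟩
        M * (h u v + h v u) ∎
        where
        expand : ∀ a m b c → a * (m * b - m * c) ≡ m * (b * a) - m * (c * a)
        expand = solve-∀ ℚ-ring
        collect : ∀ m a b → m * (a + - 1ℚ * 0ℚ) - m * (0ℚ + - 1ℚ * b) ≡ m * (a + b)
        collect = solve-∀ ℚ-ring

    -- Rayleigh monotonicity for the right-hand side `M * b i`, with one factor `M` cancelled. The
    -- pole of `b i` does not contribute to its pairing with `h′ i`, which vanishes at `i`.
    pointwise : ∀ i → d′ ∙ g i - M′ * g i i ≤ M * (d′ ∙ h′ i)
    pointwise i = *-cancelˡ-≤ 0<M (begin
      M * (d′ ∙ g i - M′ * g i i)
        ≡⟨ cong (M *_) (sym (b∙ i (g i))) ⟩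
      M * (b i ∙ g i)
        ≡⟨ sym (∙-*ˡ M (b i) (g i)) ⟩
      (λ j → M * b i j) ∙ g i
        ≤⟨ rayleigh G H w′≤w (λ j → M * b i j) (λ j → M * h′ i j) (g i) Lap-Mh′ (Lap-g i) ⟩
      (λ j → M * b i j) ∙ (λ j → M * h′ i j)
        ≡⟨ trans (∙-*ˡ M (b i) (λ j → M * h′ i j)) (cong (M *_) (∙-*ʳ (b i) M (h′ i))) ⟩
      M * (M * (b i ∙ h′ i))
        ≡⟨ cong (λ z → M * (M * z)) (trans (b∙ i (h′ i))
             (trans (cong (λ z → d′ ∙ h′ i - M′ * z) (h′-target i)) (drop (d′ ∙ h′ i) M′))) ⟩
      M * (M * (d′ ∙ h′ i)) ∎)
      where
      open ≤-Reasoning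
      drop : ∀ a m → a - m * 0ℚ ≡ a
      drop = solve-∀ ℚ-ring
      Lap-Mh′ : ∀ j → Lap′ (λ k → M * h′ i k) j ≡ M * b i j
      Lap-Mh′ j = trans (Lap-* H M (h′ i) j) (cong (M *_) (Lap-h′ i j))

    -- The inequalities `pointwise i` are averaged with the weights `d′ i`. On the right this
    -- produces `K′` through `average′`; on the left it produces the claim plus a multiple of the
    -- commute time, which is dropped.
    kemeny-deletion : M * M′ * K - (d ∙ h u + d ∙ h v) ≤ M * M′ * K′
    kemeny-deletion = *-cancelˡ-≤ 0<M′ (begin
      M′ * (M * M′ * K - (d ∙ h u + d ∙ h v))
        ≤⟨ ≤-by (M′ * (h u v + h v u)) (0≤* (ℚ.<⇒≤ 0<M′) 0≤h+h) total-g ⟩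
      d′ ∙ (λ i → d′ ∙ g i - M′ * g i i)
        ≤⟨ ∑-mono (λ i → *-monoˡ-≤ (0≤d′ i) (pointwise i)) ⟩
      d′ ∙ (λ i → M * (d′ ∙ h′ i))
        ≡⟨ ∙-*ʳ d′ M (λ i → d′ ∙ h′ i) ⟩
      M * (d′ ∙ (λ i → d′ ∙ h′ i))
        ≡⟨ cong (M *_) (trans (∙-swap d′ d′ h′) (trans (∙-congʳ d′ average′) (∙-constʳ d′ (M′ * K′)))) ⟩
      M * (M′ * (M′ * K′))
        ≡⟨ regroup M M′ K′ ⟩
      M′ * (M * M′ * K′) ∎)
      where
      open ≤-Reasoning
      regroup : ∀ a b c → a * (b * (b * c)) ≡ b * (a * b * c)
      regroup = solve-∀ ℚ-ring
      U = d′ ∙ h u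
      V = d′ ∙ h v
      g-row : ∀ i → d′ ∙ g i - M′ * g i i ≡ M′ * (d′ ∙ h i) + ((U + V) + - M′ * (h u i + h v i))
      g-row i = trans (cong₂ (λ y z → y - M′ * (M′ * z + (h u i + h v i)))
          (trans (∙-+ʳ d′ (λ j → M′ * h i j) (λ j → h u j + h v j))
            (cong₂ _+_ (∙-*ʳ d′ M′ (h i)) (∙-+ʳ d′ (h u) (h v))))
          (h-target i))
        (collect M′ (d′ ∙ h i) (U + V) (h u i + h v i))
        where
        collect : ∀ m a x y → m * a + x - m * (m * 0ℚ + y) ≡ m * a + (x + - m * y)
        collect = solve-∀ ℚ-ring
      double : d′ ∙ (λ i → d′ ∙ h i) ≡ M′ * (M * K) - (U + V)
      double = E.begin
        d′ ∙ (λ i → d′ ∙ h i)                      E.≡⟨ ∙-swap d′ d′ h ⟩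
        d′ ∙ (λ j → d′ ∙ (λ i → h i j))            E.≡⟨ ∙-congʳ d′ (λ j → trans (column j) (minus (M * K) (h u j + h v j))) ⟩
        d′ ∙ (λ j → M * K + - 1ℚ * (h u j + h v j)) E.≡⟨ trans (∙-+ʳ d′ (λ _ → M * K) (λ j → - 1ℚ * (h u j + h v j)))
                                                        (cong₂ _+_ (∙-constʳ d′ (M * K))
                                                          (trans (∙-*ʳ d′ (- 1ℚ) (λ j → h u j + h v j))
                                                            (cong (- 1ℚ *_) (∙-+ʳ d′ (h u) (h v))))) ⟩
        M′ * (M * K) + - 1ℚ * (U + V)              E.≡⟨ sym (minus (M′ * (M * K)) (U + V)) ⟩
        M′ * (M * K) - (U + V)                     E.∎
        where
        module E = ≡-Reasoning
        minus : ∀ a b → a - b ≡ a + - 1ℚ * b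
        minus = solve-∀ ℚ-ring
      -- The summands `h u + h v` of `g i` cancel in the weighted sum. The loss comes from `double`,
      -- where `d′` replaces `d` in the average over targets; rewriting `d′ ∙ h u` and `d′ ∙ h v`
      -- with `d` leaves the commute time.
      total-g : d′ ∙ (λ i → d′ ∙ g i - M′ * g i i) ≡
        M′ * (M * M′ * K - (d ∙ h u + d ∙ h v)) + M′ * (h u v + h v u)
      total-g = E.begin
        d′ ∙ (λ i → d′ ∙ g i - M′ * g i i)
          E.≡⟨ ∙-congʳ d′ g-row ⟩
        d′ ∙ (λ i → M′ * (d′ ∙ h i) + ((U + V) + - M′ * (h u i + h v i)))
          E.≡⟨ trans (∙-+ʳ d′ (λ i → M′ * (d′ ∙ h i)) (λ i → (U + V) + - M′ * (h u i + h v i)))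
                 (cong₂ _+_ (trans (∙-*ʳ d′ M′ (λ i → d′ ∙ h i)) (cong (M′ *_) double))
                   (trans (∙-+ʳ d′ (λ _ → U + V) (λ i → - M′ * (h u i + h v i)))
                     (cong₂ _+_ (∙-constʳ d′ (U + V))
                       (trans (∙-*ʳ d′ (- M′) (λ i → h u i + h v i))
                         (cong (- M′ *_) (∙-+ʳ d′ (h u) (h v))))))) ⟩
        M′ * (M′ * (M * K) - (U + V)) + (M′ * (U + V) + - M′ * (U + V))
          E.≡⟨ cong₂ (λ y z → M′ * (M′ * (M * K) - (y + z)) + (M′ * (U + V) + - M′ * (U + V)))
                 (trans (d′∙h u) (cong (λ z → d ∙ h u - (z + h u v)) (h-target u)))
                 (trans (d′∙h v) (cong (λ z → d ∙ h v - (h v u + z)) (h-target v))) ⟩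
        M′ * (M′ * (M * K) - ((d ∙ h u - (0ℚ + h u v)) + (d ∙ h v - (h v u + 0ℚ)))) + (M′ * (U + V) + - M′ * (U + V))
          E.≡⟨ collect M M′ K (d ∙ h u) (d ∙ h v) (h u v) (h v u) (U + V) ⟩
        M′ * (M * M′ * K - (d ∙ h u + d ∙ h v)) + M′ * (h u v + h v u) E.∎
        where
        module E = ≡-Reasoning
        collect : ∀ m m′ k a b x y z →
          m′ * (m′ * (m * k) - ((a - (0ℚ + x)) + (b - (y + 0ℚ)))) + (m′ * z + - m′ * z) ≡
          m′ * (m * m′ * k - (a + b)) + m′ * (x + y)
        collect = solve-∀ ℚ-ring

-- Conductance and the co-area inequality

χ : (Fin n → Bool) → Fin n → ℚ
χ p i = if p i then 1ℚ else 0ℚ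

0≤χ : ∀ (p : Fin n → Bool) i → 0ℚ ≤ χ p i
0≤χ p i with p i
... | true  = ℚ.<⇒≤ (ℚ.positive⁻¹ 1ℚ)
... | false = ℚ.≤-refl

χ≤1 : ∀ (p : Fin n → Bool) i → χ p i ≤ 1ℚ
χ≤1 p i with p i
... | true  = ℚ.≤-refl
... | false = ℚ.<⇒≤ (ℚ.positive⁻¹ 1ℚ)

χ≡1 : ∀ (p : Fin n → Bool) {i} → p i ≡ true → χ p i ≡ 1ℚ
χ≡1 p e rewrite e = refl

χ≡0 : ∀ (p : Fin n → Bool) {i} → p i ≡ false → χ p i ≡ 0ℚ
χ≡0 p e rewrite e = refl

χ-not : ∀ (p : Fin n → Bool) i → χ (not ∘ p) i ≡ 1ℚ - χ p i
χ-not p i with p i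
... | true  = refl
... | false = refl

fromℕ-⊓ : ∀ a b → fromℕ a ≤ fromℕ b → fromℕ (a ℕ.⊓ b) ≡ fromℕ a
fromℕ-⊓ a b a≤b with ℕ.≤-total a b
... | inj₁ le = cong fromℕ (ℕ.m≤n⇒m⊓n≡m le)
... | inj₂ ge = trans (cong fromℕ (ℕ.m≥n⇒m⊓n≡n ge)) (ℚ.≤-antisym (fromℕ-mono ge) a≤b)

⊓-elim : ∀ {P : ℕ → Set} a b → P a → P b → P (a ℕ.⊓ b)
⊓-elim {P} a b Pa Pb with ℕ.⊓-sel a b
... | inj₁ e = subst P (sym e) Pa
... | inj₂ e = subst P (sym e) Pb

≢true⇒≡false : ∀ {b} → b ≢ true → b ≡ false
≢true⇒≡false {true}  ≢ = contradiction refl ≢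
≢true⇒≡false {false} _ = refl

module Conductance (G : Graph n) where

  open Network G

  -- Ordered pairs are summed, so the indicator of S has variation twice the
  -- size of the cut.
  TV : (Fin n → ℚ) → ℚ
  TV g = ∑∑ λ i j → w i j * ∣ g i - g j ∣

  0≤TV-term : ∀ (g : Fin n → ℚ) i j → 0ℚ ≤ w i j * ∣ g i - g j ∣
  0≤TV-term g i j = 0≤* (0≤w i j) (ℚ.0≤∣p∣ (g i - g j))

  0≤TV : ∀ g → 0ℚ ≤ TV g
  0≤TV g = 0≤∑ λ i → 0≤∑ (0≤TV-term g i)

  vol≡ : ∀ S → fromℕ (vol G S) ≡ d ∙ χ (lookup S)
  vol≡ S = trans (fromℕ-sum (λ i → if lookup S i then degree G i else 0)) (∑-cong term)
    where
    term : ∀ i → fromℕ (if lookup S i then degree G i else 0) ≡ d i * χ (lookup S) i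
    term i with lookup S i
    ... | true  = trans (degree≡d i) (sym (ℚ.*-identityʳ (d i)))
    ... | false = sym (ℚ.*-zeroʳ (d i))

  vol-∁ : ∀ S → fromℕ (vol G (∁ S)) ≡ M - d ∙ χ (lookup S)
  vol-∁ S = begin
    fromℕ (vol G (∁ S))                        ≡⟨ vol≡ (∁ S) ⟩
    d ∙ χ (lookup (∁ S))                       ≡⟨ ∑-cong (λ i → cong (d i *_) (trans
                                                    (cong (if_then 1ℚ else 0ℚ) (lookup-map i not S))
                                                    (χ-not (lookup S) i))) ⟩
    ∑ (λ i → d i * (1ℚ - χ (lookup S) i))      ≡⟨ ∑-cong (λ i → expand (d i) (χ (lookup S) i)) ⟩
    ∑ (λ i → d i - d i * χ (lookup S) i)       ≡⟨ ∑-sub d (λ i → d i * χ (lookup S) i) ⟩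
    M - d ∙ χ (lookup S)                       ∎
    where
    open ≡-Reasoning
    expand : ∀ a b → a * (1ℚ - b) ≡ a - a * b
    expand = solve-∀ ℚ-ring

  cutTerm : Subset n → Fin n → Fin n → ℚ
  cutTerm S i j = w i j * (χ (lookup S) i * (1ℚ - χ (lookup S) j))

  cut≡ : ∀ S → fromℕ (cutSize G S) ≡ ∑∑ (cutTerm S)
  cut≡ S = trans (fromℕ-sum (λ i → sumℕ λ j → entry i j))
    (∑-cong λ i → trans (fromℕ-sum (entry i)) (∑-cong (term i)))
    where
    entry : Fin n → Fin n → ℕ
    entry i j = if lookup S i ∧ not (lookup S j) then adjacency G i j else 0
    term : ∀ i j → fromℕ (entry i j) ≡ cutTerm S i j
    term i j with lookup S i | lookup S j
    ... | true  | true  = sym (ℚ.*-zeroʳ (w i j))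
    ... | true  | false = trans (adjacency≡w i j) (sym (ℚ.*-identityʳ (w i j)))
    ... | false | true  = sym (ℚ.*-zeroʳ (w i j))
    ... | false | false = sym (ℚ.*-zeroʳ (w i j))

  2cut≡TV : ∀ S → 2ℚ * fromℕ (cutSize G S) ≡ TV (χ (lookup S))
  2cut≡TV S = begin
    2ℚ * fromℕ (cutSize G S)
      ≡⟨ trans (2*p≡p+p (fromℕ (cutSize G S))) (cong₂ _+_ (cut≡ S) (trans (cut≡ S) (∑-swap (cutTerm S)))) ⟩
    ∑∑ (cutTerm S) + ∑∑ (λ i j → cutTerm S j i)
      ≡⟨ sym (∑∑-+ (cutTerm S) (λ i j → cutTerm S j i)) ⟩
    ∑∑ (λ i j → cutTerm S i j + cutTerm S j i)
      ≡⟨ ∑∑-cong term ⟩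
    TV (χ (lookup S)) ∎
    where
    open ≡-Reasoning
    term : ∀ i j → cutTerm S i j + cutTerm S j i ≡ w i j * ∣ χ (lookup S) i - χ (lookup S) j ∣
    term i j = trans (cong (λ z → cutTerm S i j + z * (χ (lookup S) j * (1ℚ - χ (lookup S) i))) (w-sym j i)) (cases (w i j))
      where
      cases : ∀ x → x * (χ (lookup S) i * (1ℚ - χ (lookup S) j)) + x * (χ (lookup S) j * (1ℚ - χ (lookup S) i))
        ≡ x * ∣ χ (lookup S) i - χ (lookup S) j ∣
      cases x with lookup S i | lookup S j
      ... | true  | true  = trans (cong₂ _+_ (ℚ.*-zeroʳ x) (ℚ.*-zeroʳ x)) (sym (ℚ.*-zeroʳ x))
      ... | true  | false = trans (cong₂ _+_ (ℚ.*-identityʳ x) (ℚ.*-zeroʳ x)) (trans (ℚ.+-identityʳ x) (sym (ℚ.*-identityʳ x)))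
      ... | false | true  = trans (cong₂ _+_ (ℚ.*-zeroʳ x) (ℚ.*-identityʳ x)) (trans (ℚ.+-identityˡ x) (sym (ℚ.*-identityʳ x)))
      ... | false | false = trans (cong₂ _+_ (ℚ.*-zeroʳ x) (ℚ.*-zeroʳ x)) (sym (ℚ.*-zeroʳ x))

  cut≤vol : ∀ S → fromℕ (cutSize G S) ≤ fromℕ (vol G S)
  cut≤vol S = begin
    fromℕ (cutSize G S)                        ≡⟨ cut≡ S ⟩
    ∑∑ (cutTerm S)                             ≤⟨ ∑∑-mono (λ i j → ≤-by (w i j * (x i * x j))
                                                   (0≤* (0≤w i j) (0≤* (0≤χ (lookup S) i) (0≤χ (lookup S) j)))
                                                   (split (w i j) (x i) (x j))) ⟩
    ∑∑ (λ i j → w i j * x i)                   ≡⟨ ∑-cong (λ i → ∑-*ʳ (x i) (w i)) ⟩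
    d ∙ x                                      ≡⟨ sym (vol≡ S) ⟩
    fromℕ (vol G S)                            ∎
    where
    open ≤-Reasoning
    x = χ (lookup S)
    split : ∀ a b c → a * b ≡ a * (b * (1ℚ - c)) + a * (b * c)
    split = solve-∀ ℚ-ring

  cut≤vol-∁ : ∀ S → fromℕ (cutSize G S) ≤ fromℕ (vol G (∁ S))
  cut≤vol-∁ S = begin
    fromℕ (cutSize G S)                        ≡⟨ trans (cut≡ S) (∑-swap (cutTerm S)) ⟩
    ∑∑ (λ j i → cutTerm S i j)                 ≤⟨ ∑∑-mono (λ j i → ≤-by (w i j * ((1ℚ - x i) * (1ℚ - x j)))
                                                   (0≤* (0≤w i j) (0≤* (0≤1-χ i) (0≤1-χ j)))
                                                   (trans (cong (_* (1ℚ - x j)) (w-sym j i)) (split (w i j) (x i) (x j)))) ⟩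
    ∑∑ (λ j i → w j i * (1ℚ - x j))            ≡⟨ ∑-cong (λ j → trans (∑-*ʳ (1ℚ - x j) (w j)) (expand (d j) (x j))) ⟩
    ∑ (λ j → d j - d j * x j)                  ≡⟨ ∑-sub d (λ j → d j * x j) ⟩
    M - d ∙ x                                  ≡⟨ sym (vol-∁ S) ⟩
    fromℕ (vol G (∁ S))                        ∎
    where
    open ≤-Reasoning
    x = χ (lookup S)
    0≤1-χ : ∀ i → 0ℚ ≤ 1ℚ - x i
    0≤1-χ i = subst (0ℚ ≤_) (χ-not (lookup S) i) (0≤χ (not ∘ lookup S) i)
    split : ∀ a b c → a * (1ℚ - c) ≡ a * (b * (1ℚ - c)) + a * ((1ℚ - b) * (1ℚ - c))
    split = solve-∀ ℚ-ring
    expand : ∀ a b → a * (1ℚ - b) ≡ a - a * b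
    expand = solve-∀ ℚ-ring

  module _ (connected : Connected G) (2≤n : 2 ℕ.≤ n) where

    -- An empty cut makes the indicator of `S` a function of zero energy, hence constant on a
    -- connected graph, although it takes both values `0ℚ` and `1ℚ`.
    0<cut : ∀ S → Nonempty S → S ⊂ ⊤ → 0ℚ < fromℕ (cutSize G S)
    0<cut S (i , i∈S) (_ , j , _ , j∉S) = ℚ.≰⇒> λ cut≤0 →
      let TV≡0 : TV x ≡ 0ℚ
          TV≡0 = trans (sym (2cut≡TV S))
            (cong (2ℚ *_) (ℚ.≤-antisym cut≤0 (0≤fromℕ (cutSize G S))))
      in contradiction
        (trans (sym (χ≡1 (lookup S) ([]=⇒lookup i∈S)))
          (trans (𝓔≡0⇒constant connected x (flat TV≡0) i j)
            (χ≡0 (lookup S) (≢true⇒≡false (j∉S ∘ lookup⇒[]= j S))))) λ ()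
      where
      x = χ (lookup S)
      flat : TV x ≡ 0ℚ → 𝓔 x x ≡ 0ℚ
      flat TV≡0 = ∑-≡0 λ i → ∑-≡0 λ j → begin
        w i j * ((x i - x j) * (x i - x j))
          ≡⟨ cong (w i j *_) (sym (∣∣-sq (x i - x j))) ⟩
        w i j * (∣ x i - x j ∣ * ∣ x i - x j ∣)
          ≡⟨ sym (ℚ.*-assoc (w i j) ∣ x i - x j ∣ ∣ x i - x j ∣) ⟩
        w i j * ∣ x i - x j ∣ * ∣ x i - x j ∣
          ≡⟨ cong (_* ∣ x i - x j ∣) (∑≡0⇒≡0 (0≤TV-term x i) (∑≡0⇒≡0 (λ i → 0≤∑ (0≤TV-term x i)) TV≡0 i) j) ⟩
        0ℚ * ∣ x i - x j ∣
          ≡⟨ ℚ.*-zeroˡ ∣ x i - x j ∣ ⟩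
        0ℚ ∎
        where open ≡-Reasoning

    module _ {φ : ℚ} (isConductance : IsConductance G φ) where

      open IsConductance isConductance

      private
        S₀ = proj₁ attained
        m = fromℕ (vol G S₀ ℕ.⊓ vol G (∁ S₀))

        cut≤m : fromℕ (cutSize G S₀) ≤ m
        cut≤m = ⊓-elim {P = λ k → fromℕ (cutSize G S₀) ≤ fromℕ k} (vol G S₀) (vol G (∁ S₀))
          (cut≤vol S₀) (cut≤vol-∁ S₀)

        0<cut₀ : 0ℚ < fromℕ (cutSize G S₀)
        0<cut₀ = 0<cut S₀ (proj₁ (proj₂ attained)) (proj₁ (proj₂ (proj₂ attained)))

        -- Excludes the default value of `÷₀` in the ratio that attains `φ`.
        0<m : 0ℚ < m
        0<m = ℚ.<-≤-trans 0<cut₀ cut≤m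

        m*φ : m * φ ≡ fromℕ (cutSize G S₀)
        m*φ = trans (cong (m *_) (proj₂ (proj₂ (proj₂ attained))))
          (÷₀-* (fromℕ (cutSize G S₀)) (0<⇒≢0 0<m))

      0<φ : 0ℚ < φ
      0<φ = ℚ.*-cancelˡ-<-nonNeg m {{nonNegative (ℚ.<⇒≤ 0<m)}}
        (subst (_< m * φ) (sym (ℚ.*-zeroʳ m)) (subst (0ℚ <_) (sym m*φ) 0<cut₀))

      -- Each cut edge has an end on either side and so contributes to both volumes. The bound makes
      -- `γ` positive in Cheeger's inequality.
      φ≤1 : φ ≤ 1ℚ
      φ≤1 = *-cancelˡ-≤ 0<m (subst (_≤ m * 1ℚ) (sym m*φ)
        (subst (fromℕ (cutSize G S₀) ≤_) (sym (ℚ.*-identityʳ m)) cut≤m))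

      -- The hypothesis on the volume acts twice: it makes the volume of `S` the minimum in the cut
      -- ratio, and it makes a nonempty `S` proper, since a full `S` would give `V ≤ M - V` with
      -- right-hand side zero.
      isoperimetric : ∀ S → 2ℚ * (d ∙ χ (lookup S)) ≤ M →
                      2ℚ * φ * (d ∙ χ (lookup S)) ≤ TV (χ (lookup S))
      isoperimetric S half with Sub.nonempty? S
      ... | no empty = subst (_≤ TV (χ (lookup S)))
        (sym (trans (cong (2ℚ * φ *_) (∑-≡0 λ i → trans (cong (d i *_) (χ≡0 (lookup S)
          (≢true⇒≡false λ e → empty (i , lookup⇒[]= i S e)))) (ℚ.*-zeroʳ (d i))))
          (ℚ.*-zeroʳ (2ℚ * φ))))
        (0≤TV (χ (lookup S)))
      ... | yes (i , i∈S) = begin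
        2ℚ * φ * V                  ≡⟨ regroup φ V ⟩
        2ℚ * (V * φ)                ≤⟨ *-monoˡ-≤ (ℚ.<⇒≤ (ℚ.positive⁻¹ 2ℚ)) (*-monoˡ-≤ (ℚ.<⇒≤ 0<V) (lowerBound S (i , i∈S) S⊂⊤)) ⟩
        2ℚ * (V * cutRatio G S)     ≡⟨ cong (2ℚ *_) (subst (λ z → z * cutRatio G S ≡ fromℕ (cutSize G S)) m≡V
                                         (÷₀-* (fromℕ (cutSize G S)) λ m≡0 → 0<⇒≢0 0<V (trans (sym m≡V) m≡0))) ⟩
        2ℚ * fromℕ (cutSize G S)    ≡⟨ 2cut≡TV S ⟩
        TV (χ (lookup S))           ∎
        where
        open ≤-Reasoning
        V = d ∙ χ (lookup S)
        regroup : ∀ a b → 2ℚ * a * b ≡ 2ℚ * (b * a)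
        regroup = solve-∀ ℚ-ring
        0<V : 0ℚ < V
        0<V = ℚ.<-≤-trans (0<d connected 2≤n i) (subst (_≤ V)
          (trans (cong (d i *_) (χ≡1 (lookup S) ([]=⇒lookup i∈S))) (ℚ.*-identityʳ (d i)))
          (term≤∑ (λ j → 0≤* (0≤d j) (0≤χ (lookup S) j)) i))
        halves : ∀ a b → b - a ≡ a + (b - 2ℚ * a)
        halves = solve-∀ ℚ-ring
        V≤M-V : V ≤ M - V
        V≤M-V = ≤-by (M - 2ℚ * V) (≤⇒0≤- half) (halves V M)
        m≡V : fromℕ (vol G S ℕ.⊓ vol G (∁ S)) ≡ V
        m≡V = trans (fromℕ-⊓ (vol G S) (vol G (∁ S)) (begin
          fromℕ (vol G S)       ≡⟨ vol≡ S ⟩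
          V                     ≤⟨ V≤M-V ⟩
          M - V                 ≡⟨ sym (vol-∁ S) ⟩
          fromℕ (vol G (∁ S))   ∎)) (vol≡ S)
        S⊂⊤ : S ⊂ ⊤
        S⊂⊤ with Sub.nonempty? (∁ S)
        ... | yes (j , j∈∁S) = Sub.⊆⊤ , j , Sub.∈⊤ , Sub.x∈∁p⇒x∉p j∈∁S
        ... | no  ∁S-empty   = contradiction (ℚ.<-≤-trans 0<V (ℚ.≤-trans V≤M-V (ℚ.≤-reflexive M-V≡0))) (ℚ.<-irrefl refl)
          where
          full : ∀ i → χ (lookup S) i ≡ 1ℚ
          full i with lookup S i in e
          ... | true  = refl
          ... | false = contradiction (i , Sub.x∉p⇒x∈∁p λ i∈S → contradiction (trans (sym e) ([]=⇒lookup i∈S)) λ ()) ∁S-empty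
          M-V≡0 : M - V ≡ 0ℚ
          M-V≡0 = trans (cong (λ z → M - z) (∑-cong λ i → trans (cong (d i *_) (full i)) (ℚ.*-identityʳ (d i))))
            (ℚ.+-inverseʳ M)

-- Medians, positive and negative parts

does⇒ : {A : Set} (a? : Dec A) → does a? ≡ true → A
does⇒ (yes a) _ = a

infix 5 _<ᵇ_ _≤ᵇ_

opaque

  _<ᵇ_ _≤ᵇ_ : ℚ → ℚ → Bool
  p <ᵇ q = does (p ℚ.<? q)
  p ≤ᵇ q = does (p ℚ.≤? q)

  <ᵇ⇒< : ∀ p q → p <ᵇ q ≡ true → p < q
  <ᵇ⇒< p q = does⇒ (p ℚ.<? q)

  ≮ᵇ⇒≥ : ∀ p q → p <ᵇ q ≡ false → q ≤ p
  ≮ᵇ⇒≥ p q e = ℚ.≮⇒≥ λ p<q → contradiction (trans (sym e) (dec-true (p ℚ.<? q) p<q)) λ ()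

  ≥⇒≮ᵇ : ∀ p q → q ≤ p → p <ᵇ q ≡ false
  ≥⇒≮ᵇ p q q≤p = dec-false (p ℚ.<? q) λ p<q → ℚ.<-irrefl refl (ℚ.<-≤-trans p<q q≤p)

  ≤ᵇ⇒≤ : ∀ p q → p ≤ᵇ q ≡ true → p ≤ q
  ≤ᵇ⇒≤ p q = does⇒ (p ℚ.≤? q)

  ≤⇒≤ᵇ : ∀ p q → p ≤ q → p ≤ᵇ q ≡ true
  ≤⇒≤ᵇ p q = dec-true (p ℚ.≤? q)

above below : (Fin n → ℚ) → ℚ → Fin n → Bool
above f c i = c <ᵇ f i
below f c i = f i <ᵇ c

maximiser : (f : Fin n → ℚ) (P : Fin n → Bool) → ∃[ i ] P i ≡ true →
            ∃[ i ] (P i ≡ true × ∀ j → P j ≡ true → f j ≤ f i)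
maximiser f P ∃i with minimiser (λ i → - f i) P ∃i
... | i , Pi , i-min = i , Pi , λ j Pj →
  ≤-by (- f j - - f i) (≤⇒0≤- (i-min j Pj)) (regroup (f i) (f j))
  where
  regroup : ∀ a b → a ≡ b + (- b - - a)
  regroup = solve-∀ ℚ-ring

-- The median is the least value with at most half of the weight above it.
median : (a f : Fin n → ℚ) → (∀ i → 0ℚ ≤ a i) → Fin n →
         ∃[ c ] (2ℚ * (a ∙ χ (above f c)) ≤ ∑ a × 2ℚ * (a ∙ χ (below f c)) ≤ ∑ a)
median {n} a f 0≤a i₀ = from-least (minimiser f light (top , light-top))
  where
  light : Fin n → Bool
  light i = 2ℚ * (a ∙ χ (above f (f i))) ≤ᵇ ∑ a
  weightless : ∀ p → (∀ i → p i ≡ false) → 2ℚ * (a ∙ χ p) ≤ ∑ a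
  weightless p empty = subst (_≤ ∑ a)
    (sym (trans (cong (2ℚ *_) (∑-≡0 λ i → trans (cong (a i *_) (χ≡0 p (empty i))) (ℚ.*-zeroʳ (a i)))) (ℚ.*-zeroʳ 2ℚ)))
    (0≤∑ 0≤a)
  maximum = maximiser f (λ _ → true) (i₀ , refl)
  top = proj₁ maximum
  light-top : light top ≡ true
  light-top = ≤⇒≤ᵇ _ _ (weightless (above f (f top)) λ i →
    ≥⇒≮ᵇ (f top) (f i) (proj₂ (proj₂ maximum) i refl))
  from-least : ∃[ i ] (light i ≡ true × ∀ j → light j ≡ true → f i ≤ f j) →
               ∃[ c ] (2ℚ * (a ∙ χ (above f c)) ≤ ∑ a × 2ℚ * (a ∙ χ (below f c)) ≤ ∑ a)
  from-least (i , light-i , i-min) = f i , ≤ᵇ⇒≤ _ _ light-i , below-light (any? λ j → below f (f i) j Bool.≟ true)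
    where
    below-light : Dec (∃ λ j → below f (f i) j ≡ true) → 2ℚ * (a ∙ χ (below f (f i))) ≤ ∑ a
    below-light (no none) = weightless (below f (f i)) λ j → ≢true⇒≡false λ e → none (j , e)
    below-light (yes some) = under (maximiser f (below f (f i)) some)
      where
      under : ∃[ k ] (below f (f i) k ≡ true × ∀ j → below f (f i) j ≡ true → f j ≤ f k) →
              2ℚ * (a ∙ χ (below f (f i))) ≤ ∑ a
      -- The vertex `k` carries the largest value below the median. By minimality of the median more
      -- than half of the weight lies above `f k`, and that set is disjoint from the set below the
      -- median.
      under (k , k-below , k-max) = ≤-by
        ((∑ a - (a ∙ χ B + a ∙ χ A)) + (∑ a - (a ∙ χ B + a ∙ χ A)) + (2ℚ * (a ∙ χ A) - ∑ a))
        (0≤+ (0≤+ (≤⇒0≤- disjoint) (≤⇒0≤- disjoint)) (≤⇒0≤- (ℚ.<⇒≤ (ℚ.≰⇒> heavy))))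
        (regroup (∑ a) (a ∙ χ B) (a ∙ χ A))
        where
        A = above f (f k)
        B = below f (f i)
        regroup : ∀ s b c → s ≡ 2ℚ * b + (s - (b + c) + (s - (b + c)) + (2ℚ * c - s))
        regroup = solve-∀ ℚ-ring
        heavy : ¬ 2ℚ * (a ∙ χ A) ≤ ∑ a
        heavy le = ℚ.<-irrefl refl (ℚ.<-≤-trans (<ᵇ⇒< (f k) (f i) k-below) (i-min k (≤⇒≤ᵇ _ _ le)))
        exclusive : ∀ j → χ B j + χ A j ≤ 1ℚ
        exclusive j = by-cases (B j) refl
          where
          by-cases : ∀ b → B j ≡ b → χ B j + χ A j ≤ 1ℚ
          by-cases false Bj rewrite χ≡0 B Bj = subst (_≤ 1ℚ) (sym (ℚ.+-identityˡ (χ A j))) (χ≤1 A j)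
          by-cases true  Bj rewrite χ≡1 B Bj | χ≡0 A (≥⇒≮ᵇ (f k) (f j) (k-max j Bj)) = ℚ.≤-refl
        disjoint : a ∙ χ B + a ∙ χ A ≤ ∑ a
        disjoint = subst (_≤ ∑ a) (∙-+ʳ a (χ B) (χ A)) (∑-mono λ j →
          subst (a j * (χ B j + χ A j) ≤_) (ℚ.*-identityʳ (a j)) (*-monoˡ-≤ (0≤a j) (exclusive j)))

opaque

  _⁺ : ℚ → ℚ
  p ⁺ = p ⊔ 0ℚ

  ⁺-nonneg : 0ℚ ≤ p → p ⁺ ≡ p
  ⁺-nonneg = ℚ.p≥q⇒p⊔q≡p

  ⁺-nonpos : p ≤ 0ℚ → p ⁺ ≡ 0ℚ
  ⁺-nonpos = ℚ.p≤q⇒p⊔q≡q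

⁺-sq : ∀ p → p ⁺ * p ⁺ + (- p) ⁺ * (- p) ⁺ ≡ p * p
⁺-sq p with ℚ.≤-total 0ℚ p
... | inj₁ 0≤p rewrite ⁺-nonneg 0≤p | ⁺-nonpos (ℚ.neg-antimono-≤ 0≤p) = drop p
  where
  drop : ∀ a → a * a + 0ℚ * 0ℚ ≡ a * a
  drop = solve-∀ ℚ-ring
... | inj₂ p≤0 rewrite ⁺-nonpos p≤0 | ⁺-nonneg (ℚ.neg-antimono-≤ p≤0) = drop p
  where
  drop : ∀ a → 0ℚ * 0ℚ + - a * - a ≡ a * a
  drop = solve-∀ ℚ-ring

-- For equal signs one of the two squares vanishes and equality holds. For opposite signs the
-- right-hand side has the additional cross term `2 ∣p∣ ∣q∣`.
⁺-contract : ∀ p q → (p ⁺ - q ⁺) * (p ⁺ - q ⁺) + ((- p) ⁺ - (- q) ⁺) * ((- p) ⁺ - (- q) ⁺) ≤ (p - q) * (p - q)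
⁺-contract p q with ℚ.≤-total 0ℚ p | ℚ.≤-total 0ℚ q
... | inj₁ 0≤p | inj₁ 0≤q rewrite ⁺-nonneg 0≤p | ⁺-nonneg 0≤q | ⁺-nonpos (ℚ.neg-antimono-≤ 0≤p) | ⁺-nonpos (ℚ.neg-antimono-≤ 0≤q) =
  ℚ.≤-reflexive (drop p q)
  where
  drop : ∀ a b → (a - b) * (a - b) + (0ℚ - 0ℚ) * (0ℚ - 0ℚ) ≡ (a - b) * (a - b)
  drop = solve-∀ ℚ-ring
... | inj₁ 0≤p | inj₂ q≤0 rewrite ⁺-nonneg 0≤p | ⁺-nonpos q≤0 | ⁺-nonpos (ℚ.neg-antimono-≤ 0≤p) | ⁺-nonneg (ℚ.neg-antimono-≤ q≤0) =
  ≤-by (2ℚ * (p * - q)) (0≤* (ℚ.<⇒≤ (ℚ.positive⁻¹ 2ℚ)) (0≤* 0≤p (ℚ.neg-antimono-≤ q≤0))) (cross p q)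
  where
  cross : ∀ a b → (a - b) * (a - b) ≡ (a - 0ℚ) * (a - 0ℚ) + (0ℚ - - b) * (0ℚ - - b) + 2ℚ * (a * - b)
  cross = solve-∀ ℚ-ring
... | inj₂ p≤0 | inj₁ 0≤q rewrite ⁺-nonpos p≤0 | ⁺-nonneg 0≤q | ⁺-nonneg (ℚ.neg-antimono-≤ p≤0) | ⁺-nonpos (ℚ.neg-antimono-≤ 0≤q) =
  ≤-by (2ℚ * (- p * q)) (0≤* (ℚ.<⇒≤ (ℚ.positive⁻¹ 2ℚ)) (0≤* (ℚ.neg-antimono-≤ p≤0) 0≤q)) (cross p q)
  where
  cross : ∀ a b → (a - b) * (a - b) ≡ (0ℚ - b) * (0ℚ - b) + (- a - 0ℚ) * (- a - 0ℚ) + 2ℚ * (- a * b)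
  cross = solve-∀ ℚ-ring
... | inj₂ p≤0 | inj₂ q≤0 rewrite ⁺-nonpos p≤0 | ⁺-nonpos q≤0 | ⁺-nonneg (ℚ.neg-antimono-≤ p≤0) | ⁺-nonneg (ℚ.neg-antimono-≤ q≤0) =
  ℚ.≤-reflexive (drop p q)
  where
  drop : ∀ a b → (0ℚ - 0ℚ) * (0ℚ - 0ℚ) + (- a - - b) * (- a - - b) ≡ (a - b) * (a - b)
  drop = solve-∀ ℚ-ring

-- Cheeger's inequality

-- With respect to the weight `d`, the vector `d u - ∑ d * δ u` has mean zero, square norm
-- `∑ d * (d u * (∑ d - d u))` and, because `f u` is zero, pairing `d u * (d ∙ f)` with `f`. Mean
-- zero is why `c` survives only in the first term.
test-square : ∀ (d f : Fin n → ℚ) u a c τ → f u ≡ 0ℚ →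
  d ∙ (λ i → (a * (f i - c) - τ * (d u - ∑ d * δ i u)) * (a * (f i - c) - τ * (d u - ∑ d * δ i u))) ≡
  a * a * (d ∙ (λ i → (f i - c) * (f i - c))) - 2ℚ * (a * (τ * d u)) * (d ∙ f) + τ * τ * (∑ d * (d u * (∑ d - d u)))
test-square d f u a c τ fu≡0 = begin
  d ∙ (λ i → (a * (f i - c) - τ * (d u - ∑ d * δ i u)) * (a * (f i - c) - τ * (d u - ∑ d * δ i u)))
    ≡⟨ ∑-cong (λ i → expand (d i) a (f i) c τ (d u) (∑ d) (δ i u)) ⟩
  ∑ (λ i → A₁ i + A₂ i + A₃ i + δ i u * B i)
    ≡⟨ ∑-+ (λ i → A₁ i + A₂ i + A₃ i) (λ i → δ i u * B i) ⟩
  ∑ (λ i → A₁ i + A₂ i + A₃ i) + ∑ (λ i → δ i u * B i)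
    ≡⟨ cong (_+ ∑ (λ i → δ i u * B i)) (∑-+ (λ i → A₁ i + A₂ i) A₃) ⟩
  ∑ (λ i → A₁ i + A₂ i) + ∑ A₃ + ∑ (λ i → δ i u * B i)
    ≡⟨ cong (λ y → y + ∑ A₃ + ∑ (λ i → δ i u * B i)) (∑-+ A₁ A₂) ⟩
  ∑ A₁ + ∑ A₂ + ∑ A₃ + ∑ (λ i → δ i u * B i)
    ≡⟨ cong (∑ A₁ + ∑ A₂ + ∑ A₃ +_) (∑-δ u B) ⟩
  ∑ A₁ + ∑ A₂ + ∑ A₃ + d u * b (f u) (δ u u)
    ≡⟨ cong₂ (λ y z → ∑ A₁ + ∑ A₂ + ∑ A₃ + d u * b y z) fu≡0 (δ-refl u) ⟩
  ∑ A₁ + ∑ A₂ + ∑ A₃ + d u * b 0ℚ 1ℚ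
    ≡⟨ cong₂ (λ y z → y + z + ∑ A₃ + d u * b 0ℚ 1ℚ) (∑-*ˡ (a * a) _) (∑-*ˡ (- (2ℚ * (a * τ * d u))) _) ⟩
  a * a * V + (- (2ℚ * (a * τ * d u))) * (d ∙ f) + ∑ A₃ + d u * b 0ℚ 1ℚ
    ≡⟨ cong (λ y → a * a * V + (- (2ℚ * (a * τ * d u))) * (d ∙ f) + y + d u * b 0ℚ 1ℚ) (∑-*ˡ e d) ⟩
  a * a * V + (- (2ℚ * (a * τ * d u))) * (d ∙ f) + e * ∑ d + d u * b 0ℚ 1ℚ
    ≡⟨ simplify a V τ (d u) (d ∙ f) c (∑ d) ⟩
  a * a * V - 2ℚ * (a * (τ * d u)) * (d ∙ f) + τ * τ * (∑ d * (d u * (∑ d - d u))) ∎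
  where
  open ≡-Reasoning
  V = d ∙ (λ i → (f i - c) * (f i - c))
  e = 2ℚ * (a * τ * d u) * c + τ * τ * (d u * d u)
  b : ℚ → ℚ → ℚ
  b y z = 2ℚ * (a * τ * ∑ d) * (y - c) - 2ℚ * (τ * τ * (d u * ∑ d)) + τ * τ * (∑ d * ∑ d) * z
  A₁ A₂ A₃ B : Fin _ → ℚ
  A₁ i = a * a * (d i * ((f i - c) * (f i - c)))
  A₂ i = (- (2ℚ * (a * τ * d u))) * (d i * f i)
  A₃ i = e * d i
  B i = d i * b (f i) (δ i u)
  expand : ∀ d a f c τ x M δ → d * ((a * (f - c) - τ * (x - M * δ)) * (a * (f - c) - τ * (x - M * δ))) ≡
    a * a * (d * ((f - c) * (f - c))) + (- (2ℚ * (a * τ * x))) * (d * f) + (2ℚ * (a * τ * x) * c + τ * τ * (x * x)) * d +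
    δ * (d * (2ℚ * (a * τ * M) * (f - c) - 2ℚ * (τ * τ * (x * M)) + τ * τ * (M * M) * δ))
  expand = solve-∀ ℚ-ring
  simplify : ∀ a V τ x T c M → a * a * V + (- (2ℚ * (a * τ * x))) * T + (2ℚ * (a * τ * x) * c + τ * τ * (x * x)) * M +
    x * (2ℚ * (a * τ * M) * (0ℚ - c) - 2ℚ * (τ * τ * (x * M)) + τ * τ * (M * M) * 1ℚ) ≡
    a * a * V - 2ℚ * (a * (τ * x)) * T + τ * τ * (M * (x * (M - x)))
  simplify = solve-∀ ℚ-ring

module Cheeger (G : Graph n) (connected : Connected G) (2≤n : 2 ℕ.≤ n)
               {φ : ℚ} (isConductance : IsConductance G φ) where

  open Network G
  open Conductance G

  -- Peels off the layer between 0 and the minimum of g on S.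
  coarea : ∀ S (g : Fin n → ℚ) → (∀ i → 0ℚ ≤ g i) → (∀ i → lookup S i ≡ false → g i ≡ 0ℚ) →
           2ℚ * (d ∙ χ (lookup S)) ≤ M → 2ℚ * φ * (d ∙ g) ≤ TV g
  coarea S = peel S (⊂-wellFounded S)
    where
    peel : ∀ S → Acc _⊂_ S → (g : Fin n → ℚ) → (∀ i → 0ℚ ≤ g i) → (∀ i → lookup S i ≡ false → g i ≡ 0ℚ) →
           2ℚ * (d ∙ χ (lookup S)) ≤ M → 2ℚ * φ * (d ∙ g) ≤ TV g
    peel S (acc rec) g 0≤g g-supp half with Sub.nonempty? S
    ... | no empty = subst (_≤ TV g)
      (sym (trans (cong (2ℚ * φ *_) (∑-≡0 λ i → trans (cong (d i *_) (g-supp i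
        (≢true⇒≡false λ e → empty (i , lookup⇒[]= i S e)))) (ℚ.*-zeroʳ (d i))))
        (ℚ.*-zeroʳ (2ℚ * φ))))
      (0≤TV g)
    ... | yes (i , i∈S) = layer (minimiser g (lookup S) (i , []=⇒lookup i∈S))
      where
      layer : (∃[ k ] (lookup S k ≡ true × ∀ j → lookup S j ≡ true → g k ≤ g j)) →
              2ℚ * φ * (d ∙ g) ≤ TV g
      layer (k , Sk , k-min) = begin
        2ℚ * φ * (d ∙ g)
          ≡⟨ cong (2ℚ * φ *_) (trans (∙-congʳ d (λ i → split (g i) t (s i)))
               (trans (∙-+ʳ d (λ i → t * s i) g′) (cong (_+ d ∙ g′) (∙-*ʳ d t s)))) ⟩
        2ℚ * φ * (t * (d ∙ s) + d ∙ g′)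
          ≡⟨ distrib (2ℚ * φ) t (d ∙ s) (d ∙ g′) ⟩
        t * (2ℚ * φ * (d ∙ s)) + 2ℚ * φ * (d ∙ g′)
          ≤⟨ ℚ.+-mono-≤ (*-monoˡ-≤ (0≤g k) (isoperimetric connected 2≤n isConductance S half))
               (peel S′ (rec (Sub.x∈p⇒p-x⊂p k∈S)) g′ 0≤g′ g′-supp half′) ⟩
        t * TV s + TV g′
          ≡⟨ sym (trans (∑∑-+ (λ i j → t * (w i j * ∣ s i - s j ∣)) (λ i j → w i j * ∣ g′ i - g′ j ∣))
               (cong (_+ TV g′) (∑∑-* t (λ i j → w i j * ∣ s i - s j ∣)))) ⟩
        ∑∑ (λ i j → t * (w i j * ∣ s i - s j ∣) + w i j * ∣ g′ i - g′ j ∣)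
          ≡⟨ ∑∑-cong (λ i j → trans (factor t (w i j) ∣ s i - s j ∣ ∣ g′ i - g′ j ∣)
               (cong (w i j *_) (layers i j))) ⟩
        TV g ∎
        where
        open ≤-Reasoning
        t = g k
        s = χ (lookup S)
        S′ = S ∖ k
        g′ : Fin n → ℚ
        g′ i = g i - t * s i
        k∈S : k ∈ S
        k∈S = lookup⇒[]= k S Sk
        split : ∀ a t b → a ≡ t * b + (a - t * b)
        split = solve-∀ ℚ-ring
        distrib : ∀ c t a b → c * (t * a + b) ≡ t * (c * a) + c * b
        distrib = solve-∀ ℚ-ring
        factor : ∀ t a x y → t * (a * x) + a * y ≡ a * (t * x + y)
        factor = solve-∀ ℚ-ring
        inside≡ : ∀ {i} → lookup S i ≡ true → g′ i ≡ g i - t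
        inside≡ {i} Si = cong (λ z → g i - z) (trans (cong (t *_) (χ≡1 (lookup S) Si)) (ℚ.*-identityʳ t))
        outside≡ : ∀ {i} → lookup S i ≡ false → g′ i ≡ 0ℚ
        outside≡ {i} Si = cong₂ _-_ (g-supp i Si) (trans (cong (t *_) (χ≡0 (lookup S) Si)) (ℚ.*-zeroʳ t))
        0≤g′ : ∀ i → 0ℚ ≤ g′ i
        0≤g′ i with lookup S i in Si
        ... | true  = subst (0ℚ ≤_) (cong (λ z → g i - z) (sym (ℚ.*-identityʳ t))) (≤⇒0≤- (k-min i Si))
        ... | false = ℚ.≤-reflexive (sym (trans (cong (λ z → z - t * 0ℚ) (g-supp i Si)) (cong (λ z → 0ℚ - z) (ℚ.*-zeroʳ t))))
        g′-supp : ∀ i → lookup S′ i ≡ false → g′ i ≡ 0ℚ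
        g′-supp i S′i with i ≟ k
        ... | yes refl = trans (inside≡ Sk) (ℚ.+-inverseʳ t)
        ... | no i≢k   = outside≡ (≢true⇒≡false λ Si → contradiction
          (trans (sym S′i) ([]=⇒lookup (Sub.x∈p∧x≢y⇒x∈p-y (lookup⇒[]= i S Si) i≢k))) λ ())
        χS′≤χS : ∀ i → χ (lookup S′) i ≤ s i
        χS′≤χS i with lookup S′ i in S′i
        ... | false = 0≤χ (lookup S) i
        ... | true  = ℚ.≤-reflexive (sym (χ≡1 (lookup S)
          ([]=⇒lookup (proj₁ (Sub.x∈p⇒p-x⊂p k∈S) (lookup⇒[]= i S′ S′i)))))
        half′ : 2ℚ * (d ∙ χ (lookup S′)) ≤ M
        half′ = ℚ.≤-trans (*-monoˡ-≤ (ℚ.<⇒≤ (ℚ.positive⁻¹ 2ℚ))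
          (∑-mono λ i → *-monoˡ-≤ (0≤d i) (χS′≤χS i))) half
        -- The variation is additive exactly, not just subadditive: `g′` vanishes outside `S` and is
        -- nonnegative inside, so across the boundary of `S` both contributions have the same sign.
        layers : ∀ i j → t * ∣ s i - s j ∣ + ∣ g′ i - g′ j ∣ ≡ ∣ g i - g j ∣
        layers i j = go (lookup S i) (lookup S j) refl refl
          where
          both : ∀ a b t → a - t - (b - t) ≡ a - b
          both = solve-∀ ℚ-ring
          one : ∀ a t → t * 1ℚ + (a - t) ≡ a
          one = solve-∀ ℚ-ring
          a-0 : ∀ a → a - 0ℚ ≡ a
          a-0 = solve-∀ ℚ-ring
          0-a : ∀ a → 0ℚ - a ≡ - a
          0-a = solve-∀ ℚ-ring
          zero′ : ∀ t → t * 0ℚ + 0ℚ ≡ 0ℚ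
          zero′ = solve-∀ ℚ-ring
          go : ∀ p q → lookup S i ≡ p → lookup S j ≡ q →
               t * ∣ s i - s j ∣ + ∣ g′ i - g′ j ∣ ≡ ∣ g i - g j ∣
          go true true Si Sj rewrite χ≡1 (lookup S) Si | χ≡1 (lookup S) Sj =
            trans (cong₂ (λ x y → x + ∣ g i - y - (g j - y) ∣) (ℚ.*-zeroʳ t) (ℚ.*-identityʳ t))
              (trans (ℚ.+-identityˡ _) (cong ∣_∣ (both (g i) (g j) t)))
          go true false Si Sj rewrite outside≡ Sj | inside≡ Si | g-supp j Sj | χ≡1 (lookup S) Si | χ≡0 (lookup S) Sj =
            trans (cong (λ z → t * 1ℚ + ∣ z ∣) (a-0 (g i - t)))
              (trans (cong (t * 1ℚ +_) (∣∣-nonneg (≤⇒0≤- (k-min i Si))))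
                (trans (one (g i) t) (sym (trans (cong ∣_∣ (a-0 (g i))) (∣∣-nonneg (0≤g i))))))
          go false true Si Sj rewrite outside≡ Si | inside≡ Sj | g-supp i Si | χ≡1 (lookup S) Sj | χ≡0 (lookup S) Si =
            trans (cong (λ z → t * 1ℚ + ∣ z ∣) (0-a (g j - t)))
              (trans (cong (t * 1ℚ +_) (trans (ℚ.∣-p∣≡∣p∣ (g j - t)) (∣∣-nonneg (≤⇒0≤- (k-min j Sj)))))
                (trans (one (g j) t) (sym (trans (cong ∣_∣ (0-a (g j))) (trans (ℚ.∣-p∣≡∣p∣ (g j)) (∣∣-nonneg (0≤g j)))))))
          go false false Si Sj rewrite outside≡ Si | outside≡ Sj | g-supp i Si | g-supp j Sj | χ≡0 (lookup S) Si | χ≡0 (lookup S) Sj =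
            zero′ t

  -- Using φ |a b| ≤ a² + (φ b / 2)² for a = g i - g j and b = g i + g j in place
  -- of the Cauchy–Schwarz inequality keeps the bound linear in 𝓔 g g.
  dirichlet-cheeger : ∀ S (g : Fin n → ℚ) → (∀ i → lookup S i ≡ false → g i ≡ 0ℚ) →
    2ℚ * (d ∙ χ (lookup S)) ≤ M →
    φ * φ * (d ∙ (λ i → g i * g i)) ≤ (1ℚ - ½ * φ * (½ * φ)) * 𝓔 g g
  dirichlet-cheeger S g g-supp half =
    ≤-by (𝓔 g g + ψ * ψ * 𝓔⁺ - φ * (2ℚ * φ * D)) (≤⇒0≤- bound) (trans
      (collect φ (𝓔 g g) D) (cong (λ z → φ * φ * D + (𝓔 g g + ψ * ψ * z - φ * (2ℚ * φ * D))) (sym 𝓔⁺≡)))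
    where
    ψ = ½ * φ
    D = d ∙ (λ i → g i * g i)
    𝓔⁺ = ∑∑ (λ i j → w i j * ((g i + g j) * (g i + g j)))
    collect : ∀ φ e x → (1ℚ - ½ * φ * (½ * φ)) * e ≡
      φ * φ * x + (e + ½ * φ * (½ * φ) * (2ℚ * (2ℚ * x) - e) - φ * (2ℚ * φ * x))
    collect = solve-∀ ℚ-ring
    -- This identity explains the weight `ψ = φ / 2`: `ψ * ψ` times `4 D` is `φ * φ * D`, which
    -- absorbs half of the left-hand side of `bound`, and the subtracted energy becomes the
    -- `- φ² / 4` in the final constant.
    𝓔⁺≡ : 𝓔⁺ ≡ 2ℚ * (2ℚ * D) - 𝓔 g g
    𝓔⁺≡ = begin
      𝓔⁺
        ≡⟨ p≡p+q-q 𝓔⁺ (𝓔 g g) ⟩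
      𝓔⁺ + 𝓔 g g - 𝓔 g g
        ≡⟨ cong (_- 𝓔 g g) (begin
             𝓔⁺ + 𝓔 g g
               ≡⟨ sym (∑∑-+ (λ i j → w i j * ((g i + g j) * (g i + g j))) (λ i j → w i j * ((g i - g j) * (g i - g j)))) ⟩
             ∑∑ (λ i j → w i j * ((g i + g j) * (g i + g j)) + w i j * ((g i - g j) * (g i - g j)))
               ≡⟨ ∑∑-cong (λ i j → parallelogram (w i j) (g i) (g j)) ⟩
             ∑∑ (λ i j → 2ℚ * (w i j * (g i * g i) + w i j * (g j * g j)))
               ≡⟨ trans (∑∑-* 2ℚ (λ i j → w i j * (g i * g i) + w i j * (g j * g j)))
                    (cong (2ℚ *_) (∑∑-+ (λ i j → w i j * (g i * g i)) (λ i j → w i j * (g j * g j)))) ⟩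
             2ℚ * (∑∑ (λ i j → w i j * (g i * g i)) + ∑∑ (λ i j → w i j * (g j * g j)))
               ≡⟨ cong (2ℚ *_) (cong₂ _+_ rows (trans (trans (∑-swap (λ i j → w i j * (g j * g j)))
                    (∑∑-cong λ j i → cong (_* (g j * g j)) (w-sym i j))) rows)) ⟩
             2ℚ * (D + D)
               ≡⟨ cong (2ℚ *_) (double D) ⟩
             2ℚ * (2ℚ * D) ∎) ⟩
      2ℚ * (2ℚ * D) - 𝓔 g g ∎
      where
      open ≡-Reasoning
      double : ∀ a → a + a ≡ 2ℚ * a
      double = solve-∀ ℚ-ring
      parallelogram : ∀ a x y → a * ((x + y) * (x + y)) + a * ((x - y) * (x - y)) ≡ 2ℚ * (a * (x * x) + a * (y * y))
      parallelogram = solve-∀ ℚ-ring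
      rows : ∑∑ (λ i j → w i j * (g i * g i)) ≡ D
      rows = ∑-cong λ i → ∑-*ʳ (g i * g i) (w i)
    pointwise : ∀ i j → φ * (w i j * ∣ g i * g i - g j * g j ∣) ≤
      w i j * ((g i - g j) * (g i - g j)) + ψ * ψ * (w i j * ((g i + g j) * (g i + g j)))
    pointwise i j = ≤-by (w i j * ((∣ a ∣ - ψ * ∣ b ∣) * (∣ a ∣ - ψ * ∣ b ∣)))
      (0≤* (0≤w i j) (0≤sq (∣ a ∣ - ψ * ∣ b ∣)))
      (trans (cong₂ (λ x y → w i j * x + ψ * ψ * (w i j * y)) (sym (∣∣-sq a)) (sym (∣∣-sq b)))
        (trans (complete φ (w i j) ∣ a ∣ ∣ b ∣) (cong (λ z → φ * (w i j * z) + w i j * ((∣ a ∣ - ψ * ∣ b ∣) * (∣ a ∣ - ψ * ∣ b ∣)))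
          (trans (sym (ℚ.∣p*q∣≡∣p∣*∣q∣ a b)) (cong ∣_∣ (difference (g i) (g j)))))))
      where
      a = g i - g j
      b = g i + g j
      difference : ∀ x y → (x - y) * (x + y) ≡ x * x - y * y
      difference = solve-∀ ℚ-ring
      complete : ∀ φ c a b → c * (a * a) + ½ * φ * (½ * φ) * (c * (b * b)) ≡
        φ * (c * (a * b)) + c * ((a - ½ * φ * b) * (a - ½ * φ * b))
      complete = solve-∀ ℚ-ring
    bound : φ * (2ℚ * φ * D) ≤ 𝓔 g g + ψ * ψ * 𝓔⁺
    bound = begin
      φ * (2ℚ * φ * D)
        ≤⟨ *-monoˡ-≤ (ℚ.<⇒≤ (0<φ connected 2≤n isConductance))
             (coarea S (λ i → g i * g i) (λ i → 0≤sq (g i))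
               (λ i Si → trans (cong (_* g i) (g-supp i Si)) (ℚ.*-zeroˡ (g i))) half) ⟩
      φ * TV (λ i → g i * g i)
        ≡⟨ sym (∑∑-* φ (λ i j → w i j * ∣ g i * g i - g j * g j ∣)) ⟩
      ∑∑ (λ i j → φ * (w i j * ∣ g i * g i - g j * g j ∣))
        ≤⟨ ∑∑-mono pointwise ⟩
      ∑∑ (λ i j → w i j * ((g i - g j) * (g i - g j)) + ψ * ψ * (w i j * ((g i + g j) * (g i + g j))))
        ≡⟨ trans (∑∑-+ (λ i j → w i j * ((g i - g j) * (g i - g j))) (λ i j → ψ * ψ * (w i j * ((g i + g j) * (g i + g j)))))
             (cong (𝓔 g g +_) (∑∑-* (ψ * ψ) (λ i j → w i j * ((g i + g j) * (g i + g j))))) ⟩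
      𝓔 g g + ψ * ψ * 𝓔⁺ ∎
      where open ≤-Reasoning

  private
    γ = 1ℚ - ½ * φ * (½ * φ)

  0<γ : 0ℚ < γ
  0<γ = ℚ.<-≤-trans (ℚ.positive⁻¹ ½) (≤-by
    (¼ * (φ * (1ℚ - φ)) + ¼ * (1ℚ - φ) + ¼)
    (0≤+ (0≤+ (0≤* 0≤¼ (0≤* (ℚ.<⇒≤ (0<φ connected 2≤n isConductance)) 0≤1-φ)) (0≤* 0≤¼ 0≤1-φ)) 0≤¼)
    (expand φ))
    where
    ¼ = ½ * ½
    0≤¼ : 0ℚ ≤ ¼
    0≤¼ = ℚ.<⇒≤ (ℚ.positive⁻¹ ¼)
    expand : ∀ φ → 1ℚ - ½ * φ * (½ * φ) ≡ ½ + (½ * ½ * (φ * (1ℚ - φ)) + ½ * ½ * (1ℚ - φ) + ½ * ½)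
    expand = solve-∀ ℚ-ring
    0≤1-φ = ≤⇒0≤- (φ≤1 connected 2≤n isConductance)

  -- For a median `c` the positive and negative parts of `f - c` live on sets of at most half the
  -- volume, where `dirichlet-cheeger` applies. Their square norms add up exactly and their energies
  -- to at most that of `f`, so the linear bounds can be added.
  poincaré : ∀ f → ∃[ c ] φ * φ * (d ∙ (λ i → (f i - c) * (f i - c))) ≤ γ * 𝓔 f f
  poincaré f = split-at (median d f 0≤d (first 2≤n))
    where
    first : ∀ {n} → 2 ℕ.≤ n → Fin n
    first (ℕ.s≤s _) = zero
    split-at : ∃[ c ] (2ℚ * (d ∙ χ (above f c)) ≤ M × 2ℚ * (d ∙ χ (below f c)) ≤ M) →
               ∃[ c ] φ * φ * (d ∙ (λ i → (f i - c) * (f i - c))) ≤ γ * 𝓔 f f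
    split-at (c , above≤ , below≤) = c , (begin
      φ * φ * (d ∙ (λ i → (f i - c) * (f i - c)))
        ≡⟨ cong (φ * φ *_) (trans (∙-congʳ d λ i → sym (⁺-sq (f i - c)))
             (∙-+ʳ d (λ i → f⁺ i * f⁺ i) (λ i → f⁻ i * f⁻ i))) ⟩
      φ * φ * (d ∙ (λ i → f⁺ i * f⁺ i) + d ∙ (λ i → f⁻ i * f⁻ i))
        ≡⟨ ℚ.*-distribˡ-+ (φ * φ) (d ∙ (λ i → f⁺ i * f⁺ i)) (d ∙ (λ i → f⁻ i * f⁻ i)) ⟩
      φ * φ * (d ∙ (λ i → f⁺ i * f⁺ i)) + φ * φ * (d ∙ (λ i → f⁻ i * f⁻ i))
        ≤⟨ ℚ.+-mono-≤
             (dirichlet-cheeger (tabulate (above f c)) f⁺ f⁺-supp (half (above f c) above≤))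
             (dirichlet-cheeger (tabulate (below f c)) f⁻ f⁻-supp (half (below f c) below≤)) ⟩
      γ * 𝓔 f⁺ f⁺ + γ * 𝓔 f⁻ f⁻
        ≡⟨ sym (ℚ.*-distribˡ-+ γ (𝓔 f⁺ f⁺) (𝓔 f⁻ f⁻)) ⟩
      γ * (𝓔 f⁺ f⁺ + 𝓔 f⁻ f⁻)
        ≤⟨ *-monoˡ-≤ (ℚ.<⇒≤ 0<γ) energies ⟩
      γ * 𝓔 f f ∎)
      where
      open ≤-Reasoning
      f⁺ f⁻ : Fin n → ℚ
      f⁺ i = (f i - c) ⁺
      f⁻ i = (- (f i - c)) ⁺
      half : ∀ s → 2ℚ * (d ∙ χ s) ≤ M → 2ℚ * (d ∙ χ (lookup (tabulate s))) ≤ M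
      half s = subst (λ z → 2ℚ * z ≤ M)
        (∙-congʳ d λ i → cong (if_then 1ℚ else 0ℚ) (sym (lookup∘tabulate s i)))
      f⁺-supp : ∀ i → lookup (tabulate (above f c)) i ≡ false → f⁺ i ≡ 0ℚ
      f⁺-supp i e = ⁺-nonpos (≤-by (c - f i)
        (≤⇒0≤- (≮ᵇ⇒≥ c (f i) (trans (sym (lookup∘tabulate (above f c) i)) e))) (cancel (f i) c))
        where
        cancel : ∀ a b → 0ℚ ≡ a - b + (b - a)
        cancel = solve-∀ ℚ-ring
      f⁻-supp : ∀ i → lookup (tabulate (below f c)) i ≡ false → f⁻ i ≡ 0ℚ
      f⁻-supp i e = ⁺-nonpos (≤-by (f i - c)
        (≤⇒0≤- (≮ᵇ⇒≥ (f i) c (trans (sym (lookup∘tabulate (below f c) i)) e))) (cancel (f i) c))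
        where
        cancel : ∀ a b → 0ℚ ≡ - (a - b) + (a - b)
        cancel = solve-∀ ℚ-ring
      shift : ∀ a b c → a - c - (b - c) ≡ a - b
      shift = solve-∀ ℚ-ring
      energies : 𝓔 f⁺ f⁺ + 𝓔 f⁻ f⁻ ≤ 𝓔 f f
      energies = subst (_≤ 𝓔 f f)
        (∑∑-+ (λ i j → w i j * ((f⁺ i - f⁺ j) * (f⁺ i - f⁺ j))) (λ i j → w i j * ((f⁻ i - f⁻ j) * (f⁻ i - f⁻ j))))
        (∑∑-mono λ i j → subst (_≤ w i j * ((f i - f j) * (f i - f j)))
          (ℚ.*-distribˡ-+ (w i j) ((f⁺ i - f⁺ j) * (f⁺ i - f⁺ j)) ((f⁻ i - f⁻ j) * (f⁻ i - f⁻ j)))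
          (*-monoˡ-≤ (0≤w i j) (subst (λ z → (f⁺ i - f⁺ j) * (f⁺ i - f⁺ j) + (f⁻ i - f⁻ j) * (f⁻ i - f⁻ j) ≤ z * z) (shift (f i) (f j) c)
            (⁺-contract (f i - c) (f j - c)))))

  module _ {K : ℚ} (hittingTimes : HittingTimes G K) where

    open HittingTimes hittingTimes

    -- Tests poincaré for h u against the multiple of d u - M δ u, which is
    -- orthogonal to the constants, that optimises the bound.
    hitting-bound : ∀ u → φ * φ * (d u * (d ∙ h u)) ≤ 2ℚ * γ * (M * (M - d u))
    hitting-bound u = from-centre (poincaré (h u))
      where
      α = φ * φ
      T = d ∙ h u
      0<α : 0ℚ < α
      0<α = 0<* (0<φ connected 2≤n isConductance) (0<φ connected 2≤n isConductance)
      from-centre : ∃[ c ] α * (d ∙ (λ i → (h u i - c) * (h u i - c))) ≤ γ * 𝓔 (h u) (h u) →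
                    α * (d u * T) ≤ 2ℚ * γ * (M * (M - d u))
      from-centre (c , bound) = *-cancelˡ-≤ (0<* (0<* (ℚ.positive⁻¹ 2ℚ) 0<γ) (0<d connected 2≤n u))
        (≤-by (α * (d u * d u) * (γ * 𝓔 (h u) (h u) - α * V) + W)
          (0≤+ (0≤* (0≤* (ℚ.<⇒≤ 0<α) (0≤sq (d u))) (≤⇒0≤- bound)) (0≤∑ λ i → 0≤* (0≤d i) (0≤sq (z i))))
          (trans (collect α (d u) γ T M V) (cong₂ (λ x y → 2ℚ * γ * d u * (α * (d u * T)) + (α * (d u * d u) * (γ * x - α * V) + y)) (sym (energy u)) (sym W≡))))
        where
        V = d ∙ (λ i → (h u i - c) * (h u i - c))
        τ = 2ℚ * γ
        -- Cauchy-Schwarz as the nonnegativity of one square. With these two coefficients, replacing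
        -- `α * V` by its bound `γ * 𝓔 (h u) (h u)`, which is `τ * T`, leaves an inequality linear
        -- in `T`, so there is no division by `T`.
        z : Fin n → ℚ
        z i = α * d u * (h u i - c) - τ * (d u - M * δ i u)
        W = d ∙ (λ i → z i * z i)
        W≡ : W ≡ α * d u * (α * d u) * V - 2ℚ * (α * d u * (τ * d u)) * T + τ * τ * (M * (d u * (M - d u)))
        W≡ = test-square d (h u) u (α * d u) c τ (h-target u)
        collect : ∀ α x γ T M V → 2ℚ * γ * x * (2ℚ * γ * (M * (M - x))) ≡
          2ℚ * γ * x * (α * (x * T)) + (α * (x * x) * (γ * (2ℚ * T) - α * V) +
            (α * x * (α * x) * V - 2ℚ * (α * x * (2ℚ * γ * x)) * T + 2ℚ * γ * (2ℚ * γ) * (M * (x * (M - x)))))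
        collect = solve-∀ ℚ-ring

-- Edge deletion and conductance

corollary5p10 : ∀ (n : ℕ) → 2 ℕ.≤ n →
    (G : Graph n) → Connected G →
    (u v : Fin n) → Edge G u v → Connected (deleteEdge G u v) →
    (KG KH φ : ℚ) →
    IsKemeny G KG → IsKemeny (deleteEdge G u v) KH → IsConductance G φ →
    KH ≥ KG + ½ - fromℕ 2 ÷₀ (φ * φ)
corollary5p10 n 2≤n G connected u v e connected′ KG KH φ kemenyG kemenyH isConductance =
  *-cancelˡ-≤ (0<* (0<* 0<M 0<M′) 0<α) (begin
    M * M′ * α * (KG + ½ - fromℕ 2 ÷₀ α)
      ≡⟨ distrib (M * M′) α KG (fromℕ 2 ÷₀ α) ⟩
    M * M′ * (α * KG + ½ * α - α * (fromℕ 2 ÷₀ α))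
      ≡⟨ cong (λ z → M * M′ * (α * KG + ½ * α - z)) (÷₀-* (fromℕ 2) (0<⇒≢0 0<α)) ⟩
    M * M′ * (α * KG + ½ * α - 2ℚ)
      -- As `2ℚ * γ` equals `2ℚ - ½ * α`, the two bounds `hitting≤` account for exactly the terms
      -- `½ * α - 2ℚ`.
      ≤⟨ ≤-by ((γ * (M * M′) - α * T u) + (γ * (M * M′) - α * T v))
           (0≤+ (≤⇒0≤- (hitting≤ u 2≤du)) (≤⇒0≤- (hitting≤ v 2≤dv)))
           (regroup (M * M′) φ KG (T u) (T v)) ⟩
    α * (M * M′ * KG - (T u + T v))
      ≤⟨ *-monoˡ-≤ (ℚ.<⇒≤ 0<α) (kemeny-deletion hG hH 0<M 0<M′) ⟩
    α * (M * M′ * KH)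
      ≡⟨ swap α (M * M′) KH ⟩
    M * M′ * α * KH ∎)
  where
  open ≤-Reasoning
  H = deleteEdge G u v
  open Network G using (d; M)
  open Network H using () renaming (d to d′; M to M′)
  open EdgeDeletion G u v e
  open Cheeger G connected 2≤n isConductance using (hitting-bound; 0<γ)
  hG = Kemeny.hittingTimes G connected 2≤n kemenyG
  hH = Kemeny.hittingTimes H connected′ 2≤n kemenyH
  open HittingTimes hG using (h)
  0<M : 0ℚ < M
  0<M = Network.0<M G connected 2≤n
  0<M′ : 0ℚ < M′
  0<M′ = Network.0<M H connected′ 2≤n
  α = φ * φ
  γ = 1ℚ - ½ * φ * (½ * φ)
  0<φ′ = Conductance.0<φ G connected 2≤n isConductance
  0<α : 0ℚ < α
  0<α = 0<* 0<φ′ 0<φ′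
  T : Fin n → ℚ
  T i = d ∙ h i
  distrib : ∀ m α k x → m * α * (k + ½ - x) ≡ m * (α * k + ½ * α - α * x)
  distrib = solve-∀ ℚ-ring
  swap : ∀ a b c → a * (b * c) ≡ b * a * c
  swap = solve-∀ ℚ-ring
  regroup : ∀ m φ k x y → φ * φ * (m * k - (x + y)) ≡ m * (φ * φ * k + ½ * (φ * φ) - 2ℚ) +
    (((1ℚ - ½ * φ * (½ * φ)) * m - φ * φ * x) + ((1ℚ - ½ * φ * (½ * φ)) * m - φ * φ * y))
  regroup = solve-∀ ℚ-ring
  -- Both ends of e have degree at least 2 because the graph without e is connected.
  2≤du : 2ℚ ≤ d u
  2≤du = subst (2ℚ ≤_) (sym (trans (d≡ u) (cong₂ (λ x y → d′ u + (x + y)) (δ-refl u) (δ-≢ u≢v))))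
    (ℚ.+-monoˡ-≤ 1ℚ (Network.1≤d H connected′ 2≤n u))
  2≤dv : 2ℚ ≤ d v
  2≤dv = subst (2ℚ ≤_) (sym (trans (d≡ v) (cong₂ (λ x y → d′ v + (x + y)) (δ-≢ (u≢v ∘ sym)) (δ-refl v))))
    (ℚ.+-monoˡ-≤ 1ℚ (Network.1≤d H connected′ 2≤n v))
  -- The degree bound enters `hitting-bound` on both sides: on the left `d i` is lowered to 2, using
  -- that `T i` is nonnegative, and on the right `M - d i` is raised to `M - 2ℚ`, which is `M′`.
  hitting≤ : ∀ i → 2ℚ ≤ d i → α * T i ≤ γ * (M * M′)
  hitting≤ i 2≤di = *-cancelˡ-≤ (ℚ.positive⁻¹ 2ℚ) (≤-by
    (α * ((d i - 2ℚ) * T i) + (2ℚ * γ * (M * (M - d i)) - α * (d i * T i)) + 2ℚ * γ * (M * (d i - 2ℚ)))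
    (0≤+ (0≤+ (0≤* (ℚ.<⇒≤ 0<α) (0≤* (≤⇒0≤- 2≤di) (HittingTimes.0≤d∙h hG i))) (≤⇒0≤- (hitting-bound hG i)))
      (0≤* (0≤* (ℚ.<⇒≤ (ℚ.positive⁻¹ 2ℚ)) (ℚ.<⇒≤ 0<γ)) (0≤* (ℚ.<⇒≤ 0<M) (≤⇒0≤- 2≤di))))
    (trans (cong (λ z → 2ℚ * (γ * (z * M′))) M≡) (trans (collect γ M′ α (d i) (T i))
      (cong (λ z → 2ℚ * (α * T i) + (α * ((d i - 2ℚ) * T i) + (2ℚ * γ * (z * (z - d i)) - α * (d i * T i)) + 2ℚ * γ * (z * (d i - 2ℚ)))) (sym M≡)))))
    where
    collect : ∀ g m a x t → 2ℚ * (g * ((m + 2ℚ) * m)) ≡ 2ℚ * (a * t) + (a * ((x - 2ℚ) * t) +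
      (2ℚ * g * ((m + 2ℚ) * (m + 2ℚ - x)) - a * (x * t)) + 2ℚ * g * ((m + 2ℚ) * (x - 2ℚ)))
    collect = solve-∀ ℚ-ring
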